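{- For every connected series-parallel multigraph $G$ (with a fixed ordering of $E(G)$) there exist constants $c_1,c_2,c_3,c_4>0$ such that the following holds: if $n\ge e(G)$, $S\subseteq V(Q_n)$ has size $\delta 2^n$, and $\delta\ge c_1n^{ -c_2}$, then at least a $c_3\delta^{c_4}$-proportion of all oriented embeddings $\psi: Q_{e(G)}\to Q_n$ satisfy $\psi(X(G))\subseteq S$.
   Context: Multigraphs may have loops and parallel edges; $e(G)=|E(G)|$. A series-parallel graph is a multigraph with no $K_4$ minor. $X(G)\subseteq\{0,1\}^{E(G)} = V(Q_{e(G)})$ is the set of indicator strings of edge sets of spanning trees of $G$. $Q_n$ is the hypercube on $\{0,1\}^n$. An embedding $Q_d\to Q_n$ is a graph isomorphism of $Q_d$ onto a $d$-dimensional face of $Q_n$; it is oriented if it preserves the coordinatewise partial orders on $\{0,1\}^d$ and $\{0,1\}^n$ (equivalently, it has the form $\psi(x)_{\sigma(j)} = x_j$ for an injection $\sigma:[d]\to[n]$, with the coordinates outside $\sigma([d])$ fixed to constant values). -}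

module Defs where

open import Data.Nat as ℕ using (ℕ; zero; suc; NonZero; _∸_)
open import Data.Nat.Properties using (m^n≢0)
open import Data.Nat.Combinatorics using (_P_)
open import Data.Integer using (+_)
open import Data.Rational as ℚ using (ℚ; 1ℚ; _/_)
open import Data.Bool using (Bool; true; false; if_then_else_)
open import Data.Fin using (Fin)
open import Data.Vec using (Vec; []; _∷_; lookup; _[_]≔_)
open import Data.List using (List; []; _∷_; map; _++_; length; filterᵇ)
open import Data.Unit using (⊤)
open import Data.Product using (Σ; ∃; _×_; _,_; proj₁; proj₂)
open import Data.Sum using (_⊎_)
open import Relation.Nullary using (¬_)
open import Relation.Binary.PropositionalEquality using (_≡_; _≢_)

-- Multigraphs (loops and parallel edges allowed).
-- Vertices are Fin nV, edges are Fin nE (this is the fixed ordering of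
-- E(G)); each edge has an (arbitrarily oriented) pair of endpoints.

record Multigraph : Set where
  field
    nV   : ℕ
    nE   : ℕ
    ends : Fin nE → Fin nV × Fin nV
open Multigraph public

e : Multigraph → ℕ
e G = nE G

Incident : (G : Multigraph) → Fin (nE G) → Fin (nV G) → Fin (nV G) → Set
Incident G f u x = (ends G f ≡ (u , x)) ⊎ (ends G f ≡ (x , u))

data Reach (G : Multigraph) (A : Fin (nE G) → Set) : Fin (nV G) → Fin (nV G) → Set where
  here : ∀ {u} → Reach G A u u
  step : ∀ {u x w} (f : Fin (nE G)) → A f → Incident G f u x → Reach G A x w → Reach G A u w

Connected : Multigraph → Set
Connected G = NonZero (nV G) × (∀ u v → Reach G (λ _ → ⊤) u v)

-- Spanning trees: an edge set T (indicator string in {0,1}^{E(G)})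
-- such that (V(G), T) is connected and acyclic.  Acyclic: no edge of T
-- lies on a cycle of T, i.e. the endpoints of every edge f ∈ T are not
-- joined by a walk in T \ {f} (a loop is therefore never in T).

InT : (G : Multigraph) → Vec Bool (nE G) → Fin (nE G) → Set
InT G T f = lookup T f ≡ true

IsSpanningTree : (G : Multigraph) → Vec Bool (nE G) → Set
IsSpanningTree G T =
  (∀ u v → Reach G (InT G T) u v) ×
  (∀ f → InT G T f →
     ¬ Reach G (λ g → InT G T g × g ≢ f) (proj₁ (ends G f)) (proj₂ (ends G f)))

X : (G : Multigraph) → Vec Bool (nE G) → Set
X G = IsSpanningTree G

record K4Minor (G : Multigraph) : Set where
  field
    B        : Fin 4 → Fin (nV G) → Bool
    disjoint : ∀ i j v → B i v ≡ true → B j v ≡ true → i ≡ j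
    nonempty : ∀ i → ∃ λ v → B i v ≡ true
    conn     : ∀ i u v → B i u ≡ true → B i v ≡ true →
               Reach G (λ f → (B i (proj₁ (ends G f)) ≡ true) × (B i (proj₂ (ends G f)) ≡ true)) u v
    adj      : ∀ i j → i ≢ j → ∃ λ f →
               ((B i (proj₁ (ends G f)) ≡ true) × (B j (proj₂ (ends G f)) ≡ true)) ⊎
               ((B j (proj₁ (ends G f)) ≡ true) × (B i (proj₂ (ends G f)) ≡ true))

SeriesParallel : Multigraph → Set
SeriesParallel G = ¬ K4Minor G

cube : (n : ℕ) → List (Vec Bool n)
cube zero    = [] ∷ []
cube (suc n) = map (false ∷_) (cube n) ++ map (true ∷_) (cube n)

card : {n : ℕ} → (Vec Bool n → Bool) → ℕ
card {n} S = length (filterᵇ S (cube n))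

density : {n : ℕ} → (Vec Bool n → Bool) → ℚ
density {n} S = (+ card S / (2 ℕ.^ n)) {{m^n≢0 2 n}}

-- Oriented embeddings Q_d → Q_n.  Such a ψ is ψ(x)_{σ(j)} = x_j with
-- σ : [d] → [n] injective and the other coordinates fixed.  We encode ψ
-- by the pair (σ , b) where b = ψ(0…0) (so b is 0 on the image of σ);
-- distinct pairs give distinct embeddings and vice versa.

IsOrientedEmb : (d n : ℕ) → Vec (Fin n) d × Vec Bool n → Set
IsOrientedEmb d n (σ , b) =
  (∀ i j → lookup σ i ≡ lookup σ j → i ≡ j) × (∀ j → lookup b (lookup σ j) ≡ false)

applyEmb : {d n : ℕ} → Vec (Fin n) d × Vec Bool n → Vec Bool d → Vec Bool n
applyEmb ([]    , b) []       = b
applyEmb (i ∷ σ , b) (x ∷ xs) = applyEmb (σ , b [ i ]≔ x) xs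

numOrientedEmb : (d n : ℕ) → ℕ
numOrientedEmb d n = (n P d) ℕ.* (2 ℕ.^ (n ∸ d))

_^ᵠ_ : ℚ → ℕ → ℚ
q ^ᵠ zero  = 1ℚ
q ^ᵠ suc k = q ℚ.* (q ^ᵠ k)

⟦_⟧ : ℕ → ℚ
⟦ m ⟧ = + m / 1

-- Call (σ , c), with σ injective and c any point of the cube, a placement of Y ⊆ {0,1}ᵈ in S
-- if applyEmb (σ , c) maps Y into S, let h(Y) be the proportion of placements, and δ the
-- density of S.  If Y⁺ arises from Y by doubling a coordinate in parallel or in series, two
-- placements of Y that differ only in the image of that coordinate combine to a placement of
-- Y⁺, so by Cauchy–Schwarz h(Y)² ≤ 4 h(Y⁺) + O(1/n).  If Y⁺ has one more coordinate, on which
-- it is constant, then h(Y) ≤ 4 h(Y⁺) + O(1/n), because almost every point of the cube has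
-- about n/2 coordinates of each value.  Starting from δ = h in dimension 0, this gives
-- δʳ ≤ C h + K/n whenever Y is reached by such steps.
--
-- The spanning trees of G are reached: a loop or a pendant edge makes a constant coordinate,
-- a parallel pair or a vertex of degree 2 a doubled one.  If none of these is present, G is
-- simple of minimum degree 3 and has a K₄ minor: take a set U attached to the rest only at
-- s and t, an induced path from s to t through U and a component D of U minus the path; either
-- D is attached at two vertices only and replaces U, or D, the first vertex of the path and
-- the two parts of a cycle through the path form a K₄.

module Submission where

open import Defs
open import Data.Bool using (Bool; true; false; not)
import Data.Bool.Properties as Bool
open import Data.Empty using (⊥; ⊥-elim)
open import Data.Fin using (Fin; zero; suc; punchIn; punchOut)
open import Data.Fin.Patterns using (0F; 1F; 2F; 3F)
open import Data.Fin.Properties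
  using (_≟_; any?; all?; punchIn-injective; punchInᵢ≢i; punchIn-punchOut; punchOut-injective; punchOut-punchIn; punchOut-cong)
open import Data.List using (List; []; _∷_; length; filter; allFin; cartesianProduct; cartesianProductWith; _++_)
import Data.List as List
open import Data.List.Membership.Propositional using (_∈_; _∉_)
import Data.List.Membership.DecPropositional as DecMembership
open import Data.List.Membership.Propositional.Properties using (∈-allFin; ∈-filter⁺; ∈-filter⁻; ∈-map⁻)
open import Data.List.Properties using (filter-notAll; map-tabulate; length-map; length-++; length-tabulate)
open import Data.List.Relation.Unary.All using (All; []; _∷_)
import Data.List.Relation.Unary.All as All
open import Data.List.Relation.Unary.All.Properties using (¬Any⇒All¬; all-filter)
open import Data.List.Relation.Unary.AllPairs using ([]; _∷_)
open import Data.List.Relation.Unary.Any using (Any; here; there)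
import Data.List.Relation.Unary.Any as Any
open import Data.List.Relation.Unary.Unique.Propositional using (Unique)
import Data.List.Relation.Unary.Unique.Propositional.Properties as Unique
open import Data.Nat as ℕ using (ℕ; zero; suc; NonZero; _≤_; _^_; _∸_; z≤n; s≤s⁻¹; >-nonZero; >-nonZero⁻¹)
open import Data.Nat.Properties hiding (_≟_)
open import Data.Nat.Tactic.RingSolver using (solve-∀)
open import Data.Product using (Σ; ∃; _×_; _,_; proj₁; proj₂; map₂)
open import Data.Product.Properties using (,-injective)
open import Data.Sum using (_⊎_; inj₁; inj₂; [_,_]′)
open import Data.Unit using (⊤; tt)
open import Data.Vec using (Vec; []; _∷_; lookup; insertAt; removeAt; _[_]≔_)
open import Data.Vec.Properties
  using (∷-injective; insertAt-lookup; insertAt-punchIn; insertAt-removeAt; removeAt-insertAt; []≔-idempotent; []≔-commutes; []≔-lookup; lookup∘update′)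
open import Function using (_∘_; id)
open import Relation.Binary.Construct.Closure.ReflexiveTransitive using (Star; ε; _◅_; _◅◅_; gmap)
open import Relation.Binary.PropositionalEquality
  using (_≡_; _≢_; refl; sym; trans; cong; cong₂; subst; subst₂; ≢-sym; module ≡-Reasoning)
open import Relation.Nullary using (¬_; Dec; yes; no; contradiction)
open import Relation.Nullary.Decidable using (⌊_⌋; map′; _×-dec_; _⊎-dec_; _→-dec_; ¬?; decidable-stable)
open import Relation.Unary using (Decidable)

-- K₄ minors in simple graphs of minimum degree three

-- A spanning tree has at most one of two parallel edges and at least one of the two edges at a
-- vertex of degree 2. So on a doubled pair one coordinate always takes a fixed value `a` (false,
-- respectively true), while the other behaves as the old coordinate did. If the base point has the
-- value `a` at both images i and j, writing `a` there changes nothing, and each alternative becomes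
-- a placement of the old set. Cauchy-Schwarz is therefore applied to placements whose base point
-- has the value `a` at the moving coordinate; this restriction halves the count, and the square of
-- that 2 is the 4 of the overview. Only inclusions pass along the reduction, so the spanning trees
-- can be replaced by a larger decidable set. Each doubling of a coordinate doubles r, and a
-- constant coordinate leaves r alone. The lower bound on δ pays for the error K/n: if δʳ n ≥
-- (2K+1)ʳ, the error is at most half of δʳ. Hence c₁ = 2K+1, c₂ = 1/r, c₃ = 1/(2C+1) and c₄ = r.

module AbstractGraph {n : ℕ} (_~_ : Fin n → Fin n → Set)
  (~-sym : ∀ {x y} → x ~ y → y ~ x) (~? : ∀ x y → Dec (x ~ y)) where

  V : Set
  V = Fin n

  open DecMembership (_≟_ {n}) using (_∈?_)

  -- `A` binds every vertex of the walk except the first, so `Conn A u` always contains `u` and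
  -- serves directly as the component of `u`.
  Conn : (V → Set) → V → V → Set
  Conn A = Star (λ x y → x ~ y × A y)

  Conn-mono : ∀ {A B : V → Set} → (∀ {x} → A x → B x) → ∀ {u v} → Conn A u v → Conn B u v
  Conn-mono f = gmap id λ (p , q) → p , f q

  Conn-end : ∀ {A u v} → A u → Conn A u v → A v
  Conn-end a ε = a
  Conn-end _ ((_ , a) ◅ w) = Conn-end a w

  Conn-sym : ∀ {A u v} → A u → Conn A u v → Conn A v u
  Conn-sym a ε = ε
  Conn-sym a ((p , b) ◅ w) = Conn-sym b w ◅◅ (~-sym p , a) ◅ ε

  Conn-self : ∀ {A u v} → Conn A u v → Conn (Conn A u) u v
  Conn-self {A} {u} = go ε
    where
    go : ∀ {x v} → Conn A u x → Conn A x v → Conn (Conn A u) x v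
    go r ε = ε
    go r ((p , a) ◅ w) = let r′ = r ◅◅ (p , a) ◅ ε in (p , r′) ◅ go r′ w

  IsConnected : (V → Set) → Set
  IsConnected A = ∀ x y → A x → A y → Conn A x y

  star-connected : ∀ {A} c → A c → (∀ x → A x → Conn A c x) → IsConnected A
  star-connected c ac f x y ax ay = Conn-sym ac (f x ax) ◅◅ f y ay

  component-connected : ∀ A u → IsConnected (Conn A u)
  component-connected A u = star-connected u ε λ _ → Conn-self

  -- Floyd–Warshall: a walk through x ∷ xs avoids x or splits at its last visit to x.
  conn-list? : ∀ xs u v → Dec (Conn (_∈ xs) u v)
  conn-list? [] u v = map′ (λ { refl → ε }) (λ { ε → refl ; ((_ , ()) ◅ _) }) (u ≟ v)
  conn-list? (x ∷ xs) u v = map′ to from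
    (conn-list? xs u v ⊎-dec
      (any? (λ w → conn-list? xs u w ×-dec ~? w x) ×-dec conn-list? xs x v))
    where
    Split : V → V → Set
    Split u v = Conn (_∈ xs) u v ⊎ (∃ λ w → Conn (_∈ xs) u w × w ~ x) × Conn (_∈ xs) x v
    to : ∀ {u v} → Split u v → Conn (_∈ x ∷ xs) u v
    to (inj₁ w) = Conn-mono there w
    to (inj₂ ((w , p , q) , r)) = Conn-mono there p ◅◅ (q , here refl) ◅ Conn-mono there r
    from : ∀ {u v} → Conn (_∈ x ∷ xs) u v → Split u v
    from ε = inj₁ ε
    from ((p , a) ◅ w) with a | from w
    ... | here refl | inj₁ r = inj₂ ((_ , ε , p) , r)
    ... | there b   | inj₁ r = inj₁ ((p , b) ◅ r)
    ... | here refl | inj₂ (_ , r) = inj₂ ((_ , ε , p) , r)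
    ... | there b   | inj₂ ((_ , r , q) , s) = inj₂ ((_ , (p , b) ◅ r , q) , s)

  conn? : ∀ {A} → Decidable A → ∀ u v → Dec (Conn A u v)
  conn? A? u v = map′ (Conn-mono (proj₂ ∘ ∈-filter⁻ A? {xs = allFin n})) (Conn-mono (∈-filter⁺ A? (∈-allFin _)))
    (conn-list? (filter A? (allFin n)) u v)

  Adjacent : (V → Set) → (V → Set) → Set
  Adjacent A B = ∃ λ x → ∃ λ y → A x × B y × x ~ y

  Adjacent-sym : ∀ {A B} → Adjacent A B → Adjacent B A
  Adjacent-sym (x , y , a , b , p) = y , x , b , a , ~-sym p

  Disjoint : (V → Set) → (V → Set) → Set
  Disjoint A B = ∀ {x} → A x → B x → ⊥

  record K4Model : Set₁ where
    field
      B        : Fin 4 → V → Set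
      B?       : ∀ i → Decidable (B i)
      disjoint : ∀ i j v → B i v → B j v → i ≡ j
      nonempty : ∀ i → ∃ (B i)
      conn     : ∀ i → IsConnected (B i)
      adj      : ∀ i j → i ≢ j → Adjacent (B i) (B j)

  mkK4Model : (A B C D : V → Set) → Decidable A → Decidable B → Decidable C → Decidable D →
    IsConnected A → IsConnected B → IsConnected C → IsConnected D →
    Disjoint A B → Disjoint A C → Disjoint A D → Disjoint B C → Disjoint B D → Disjoint C D →
    Adjacent A B → Adjacent A C → Adjacent A D → Adjacent B C → Adjacent B D → Adjacent C D →
    K4Model
  mkK4Model A B C D A? B? C? D? cA cB cC cD dAB dAC dAD dBC dBD dCD aAB aAC aAD aBC aBD aCD = record
    { B = S
    ; B? = λ { 0F → A? ; 1F → B? ; 2F → C? ; 3F → D? }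
    ; disjoint = disj
    ; nonempty = λ { 0F → _ , proj₁ (proj₂ (proj₂ aAB)) ; 1F → _ , proj₁ (proj₂ (proj₂ aBC))
                   ; 2F → _ , proj₁ (proj₂ (proj₂ aCD)) ; 3F → _ , proj₁ (proj₂ (proj₂ (proj₂ aCD))) }
    ; conn = λ { 0F → cA ; 1F → cB ; 2F → cC ; 3F → cD }
    ; adj = ad
    }
    where
    S : Fin 4 → V → Set
    S 0F = A
    S 1F = B
    S 2F = C
    S 3F = D
    disj : ∀ i j v → S i v → S j v → i ≡ j
    disj 0F 0F v a b = refl
    disj 0F 1F v a b = ⊥-elim (dAB a b)
    disj 0F 2F v a b = ⊥-elim (dAC a b)
    disj 0F 3F v a b = ⊥-elim (dAD a b)
    disj 1F 0F v a b = ⊥-elim (dAB b a)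
    disj 1F 1F v a b = refl
    disj 1F 2F v a b = ⊥-elim (dBC a b)
    disj 1F 3F v a b = ⊥-elim (dBD a b)
    disj 2F 0F v a b = ⊥-elim (dAC b a)
    disj 2F 1F v a b = ⊥-elim (dBC b a)
    disj 2F 2F v a b = refl
    disj 2F 3F v a b = ⊥-elim (dCD a b)
    disj 3F 0F v a b = ⊥-elim (dAD b a)
    disj 3F 1F v a b = ⊥-elim (dBD b a)
    disj 3F 2F v a b = ⊥-elim (dCD b a)
    disj 3F 3F v a b = refl
    ad : ∀ i j → i ≢ j → Adjacent (S i) (S j)
    ad 0F 0F ne = ⊥-elim (ne refl)
    ad 0F 1F ne = aAB
    ad 0F 2F ne = aAC
    ad 0F 3F ne = aAD
    ad 1F 0F ne = Adjacent-sym aAB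
    ad 1F 1F ne = ⊥-elim (ne refl)
    ad 1F 2F ne = aBC
    ad 1F 3F ne = aBD
    ad 2F 0F ne = Adjacent-sym aAC
    ad 2F 1F ne = Adjacent-sym aBC
    ad 2F 2F ne = ⊥-elim (ne refl)
    ad 2F 3F ne = aCD
    ad 3F 0F ne = Adjacent-sym aAD
    ad 3F 1F ne = Adjacent-sym aBD
    ad 3F 2F ne = Adjacent-sym aCD
    ad 3F 3F ne = ⊥-elim (ne refl)

  -- U can be left only through s and t, which are joined outside U by the edge from s into
  -- the connected set W ∋ t.
  record Lobe (U : V → Set) (s t : V) : Set₁ where
    field
      U?       : Decidable U
      W        : V → Set
      W?       : Decidable W
      s∉U      : ¬ U s
      s∉W      : ¬ W s
      t∈W      : W t
      U∩W      : Disjoint U W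
      boundary : ∀ {x y} → U x → x ~ y → U y ⊎ y ≡ s ⊎ y ≡ t
      W-conn   : IsConnected W
      entry    : ∃ λ u → U u × s ~ u
      bypass   : ∃ λ w → W w × s ~ w

  -- Descent from a lobe to a K₄ or to a smaller lobe

  module Search (~-irrefl : ∀ {x} → ¬ (x ~ x)) (deg3 : ∀ v a b → ∃ λ w → v ~ w × w ≢ a × w ≢ b) where

    Smaller : (V → Set) → Set₁
    Smaller U = Σ (V → Set) λ U′ → ∃ λ s → ∃ λ t → Lobe U′ s t ×
      (∀ {x} → U′ x → U x) × ∃ λ x → U x × ¬ U′ x

    module Step {U : V → Set} {s t : V} (L : Lobe U s t) where
      open Lobe L

      -- A path through `U` whose last vertex, and no earlier one, is adjacent to `t`. The list
      -- omits the first vertex `x`, and `t` is never on it.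
      data InducedPath : V → List V → Set where
        end  : ∀ {x} → U x → x ~ t → InducedPath x []
        cons : ∀ {x y zs} → U x → ¬ (x ~ t) → x ~ y → x ≢ y →
               All (λ z → x ≢ z × ¬ (x ~ z)) zs → InducedPath y zs → InducedPath x (y ∷ zs)

      path-head∈U : ∀ {x zs} → InducedPath x zs → U x
      path-head∈U (end u _) = u
      path-head∈U (cons u _ _ _ _ _) = u

      path⊆U : ∀ {x zs} → InducedPath x zs → ∀ {z} → z ∈ x ∷ zs → U z
      path⊆U p (here refl) = path-head∈U p
      path⊆U (cons _ _ _ _ _ p) (there m) = path⊆U p m

      path-head∉ : ∀ {x zs} → InducedPath x zs → x ∉ zs
      path-head∉ (cons _ _ _ x≢y al _) (here e) = x≢y e
      path-head∉ (cons _ _ _ _ al _) (there m) = proj₁ (All.lookup al m) refl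

      path-to-t : ∀ {B x zs} → InducedPath x zs → B t → (∀ {z} → z ∈ zs → B z) → Conn B x t
      path-to-t (end _ p) bt f = (p , bt) ◅ ε
      path-to-t (cons _ _ p _ _ q) bt f = (p , f (here refl)) ◅ path-to-t q bt (f ∘ there)

      path-all-to-t : ∀ {B x zs} → InducedPath x zs → B t → (∀ {z} → z ∈ zs → B z) →
        ∀ {z} → z ∈ x ∷ zs → Conn B z t
      path-all-to-t p bt f (here refl) = path-to-t p bt f
      path-all-to-t (cons _ _ _ _ _ p) bt f (there m) = path-all-to-t p bt (f ∘ there) m

      -- The old path is entered at its last vertex that equals `a` or is adjacent to `a`; this
      -- keeps the new path induced.
      shortcut : ∀ a {z zs} → U a → ¬ (a ~ t) → InducedPath z zs → Any (λ w → a ~ w ⊎ a ≡ w) (z ∷ zs) →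
        ∃ (InducedPath a)
      shortcut a {z} {zs} ua a≁t p any with Any.any? (λ w → ~? a w ⊎-dec a ≟ w) zs
      shortcut a ua a≁t (cons _ _ _ _ _ p) any | yes later = shortcut a ua a≁t p later
      shortcut a ua a≁t p (here (inj₁ a~z)) | no none =
        _ , cons ua a≁t a~z (λ { refl → ~-irrefl a~z })
              (All.map (λ f → f ∘ inj₂ , f ∘ inj₁) (¬Any⇒All¬ _ none)) p
      shortcut a ua a≁t p (here (inj₂ refl)) | no none = _ , p
      shortcut a ua a≁t p (there later) | no none = contradiction later none

      inducedPath : ∀ {a x} → U a → Conn U a x → x ~ t → ∃ (InducedPath a)
      inducedPath {a} ua w x~t with ~? a t
      inducedPath ua w x~t | yes a~t = _ , end ua a~t
      inducedPath ua ε x~t | no a≁t = contradiction x~t a≁t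
      inducedPath ua ((a~y , uy) ◅ w) x~t | no a≁t =
        shortcut _ ua a≁t (proj₂ (inducedPath uy w x~t)) (here (inj₁ a~y))

      -- Inducedness keeps every neighbour of `p` except its successor off the path, and the
      -- boundary condition puts it into `U` unless it is `s`. At the end of the path `t` is the
      -- successor.
      path-next : ∀ {p ps} → InducedPath p ps → ∃ λ y →
        p ~ y × (∀ q → p ~ q → q ≢ s → q ≢ y → U q × q ∉ p ∷ ps)
      path-next {p} (end up p~t) = t , p~t , λ q p~q q≢s q≢t →
        [ id , (λ { (inj₁ e) → contradiction e q≢s ; (inj₂ e) → contradiction e q≢t }) ]′ (boundary up p~q) ,
        λ { (here refl) → ~-irrefl p~q }
      path-next {p} (cons {y = y} up p≁t p~y _ al _) = y , p~y , λ q p~q q≢s q≢y →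
        [ id , (λ { (inj₁ e) → contradiction e q≢s ; (inj₂ refl) → contradiction p~q p≁t }) ]′ (boundary up p~q) ,
        λ { (here refl) → ~-irrefl p~q ; (there (here e)) → q≢y e
          ; (there (there m)) → proj₂ (All.lookup al m) p~q }

      module Attach {p ps} (P : InducedPath p ps) (s~p : s ~ p) {q} (p~q : p ~ q) (q∈U : U q) (q∉P : q ∉ p ∷ ps) where

        Off : V → Set
        Off x = U x × x ∉ p ∷ ps

        Off? : Decidable Off
        Off? x = U? x ×-dec ¬? (x ∈? (p ∷ ps))

        D : V → Set
        D = Conn Off q

        D? : Decidable D
        D? = conn? Off? q

        D⊆Off : ∀ {x} → D x → Off x
        D⊆Off = Conn-end (q∈U , q∉P)

        Att : V → Set
        Att y = ∃ λ x → D x × x ~ y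

        Att? : Decidable Att
        Att? y = any? λ x → D? x ×-dec ~? x y

        -- The cycle through `p`, without `p` and with `W` as one fat vertex: the path beyond `p`
        -- leads to `t` in `W`, the bypass from `W` to `s`, and `s` is adjacent to `p`.
        Outer : V → Set
        Outer x = x ∈ ps ⊎ W x ⊎ x ≡ s

        p∉Outer : ¬ Outer p
        p∉Outer (inj₁ m) = path-head∉ P m
        p∉Outer (inj₂ (inj₁ w)) = U∩W (path-head∈U P) w
        p∉Outer (inj₂ (inj₂ refl)) = s∉U (path-head∈U P)

        ∈ps⇒U : ∀ {z} → z ∈ ps → U z
        ∈ps⇒U m = path⊆U P (there m)

        path-tail-to-t : ∀ {B x zs} → InducedPath x zs → B t → (∀ {z} → z ∈ zs → B z) →
          ∀ {z} → z ∈ zs → Conn B z t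
        path-tail-to-t p bt f m = path-all-to-t p bt f (there m)

        -- Everything is joined to `t`: the path through its last vertex, `W` by its connectedness,
        -- `s` by the bypass edge.
        suffix-connected : ∀ {x zs} → InducedPath x zs → IsConnected (λ z → z ∈ zs ⊎ W z ⊎ z ≡ s)
        suffix-connected {x} {zs} Q = star-connected t t∈B λ z bz → Conn-sym bz (to z bz)
          where
          B : V → Set
          B z = z ∈ zs ⊎ W z ⊎ z ≡ s
          t∈B : B t
          t∈B = inj₂ (inj₁ t∈W)
          fromW : ∀ {z} → W z → Conn B z t
          fromW w = Conn-mono (inj₂ ∘ inj₁) (W-conn _ _ w t∈W)
          to : ∀ z → B z → Conn B z t
          to z (inj₁ m) = path-tail-to-t Q t∈B inj₁ m
          to z (inj₂ (inj₁ w)) = fromW w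
          to z (inj₂ (inj₂ refl)) = let w , ww , s~w = bypass in (s~w , inj₂ (inj₁ ww)) ◅ fromW ww

        Result : Set₁
        Result = K4Model ⊎ Smaller U

        -- If `D` meets the cycle in no vertex but `p` and `y`, these two cut it off. `Outer`
        -- becomes the new `W`, with the edge from `p` to `s` as bypass, and `p` is a vertex lost
        -- from `U`.
        smaller : ∀ y → Outer y → (∀ z → Outer z → Att z → z ≡ y) → Result
        smaller y oy only = inj₂ (D , p , y , L′ , proj₁ ∘ D⊆Off , p , path-head∈U P , λ d → proj₂ (D⊆Off d) (here refl))
          where
          L′ : Lobe D p y
          L′ = record
            { U? = D?
            ; W = Outer
            ; W? = λ x → (x ∈? ps) ⊎-dec W? x ⊎-dec x ≟ s
            ; s∉U = λ d → proj₂ (D⊆Off d) (here refl)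
            ; s∉W = p∉Outer
            ; t∈W = oy
            ; U∩W = λ { d (inj₁ m) → proj₂ (D⊆Off d) (there m)
                      ; d (inj₂ (inj₁ w)) → U∩W (proj₁ (D⊆Off d)) w
                      ; d (inj₂ (inj₂ refl)) → s∉U (proj₁ (D⊆Off d)) }
            ; boundary = bd
            ; W-conn = suffix-connected P
            ; entry = q , ε , p~q
            ; bypass = s , inj₂ (inj₂ refl) , ~-sym s~p
            }
            where
            bd : ∀ {x z} → D x → x ~ z → D z ⊎ z ≡ p ⊎ z ≡ y
            bd {x} {z} d x~z with z ∈? (p ∷ ps) | boundary (proj₁ (D⊆Off d)) x~z
            ... | yes (here e)  | _ = inj₂ (inj₁ e)
            ... | yes (there m) | _ = inj₂ (inj₂ (only z (inj₁ m) (x , d , x~z)))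
            ... | no z∉ | inj₁ uz = inj₁ (d ◅◅ (x~z , uz , z∉) ◅ ε)
            ... | no z∉ | inj₂ (inj₁ z≡s) = inj₂ (inj₂ (only z (inj₂ (inj₂ z≡s)) (x , d , x~z)))
            ... | no z∉ | inj₂ (inj₂ refl) = inj₂ (inj₂ (only z (inj₂ (inj₁ t∈W)) (x , d , x~z)))

        -- The branch sets are `p`, `D` and two parts of the cycle. The vertex `q` makes `p`
        -- adjacent to `D`, and `s` makes it adjacent to `H₂`; the other four adjacencies are
        -- hypotheses.
        k4 : ∀ H₁ H₂ → Decidable H₁ → Decidable H₂ → IsConnected H₁ → IsConnected H₂ →
          (∀ {x} → H₁ x → Outer x) → (∀ {x} → H₂ x → Outer x) → Disjoint H₁ H₂ → Adjacent H₁ H₂ →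
          ∃ (λ y → H₁ y × p ~ y) → H₂ s → ∃ (λ y → H₁ y × Att y) → ∃ (λ y → H₂ y × Att y) → Result
        k4 H₁ H₂ H₁? H₂? c₁ c₂ H₁⊆ H₂⊆ dis ad (y , hy , p~y) h₂s (z₁ , hz₁ , x₁ , d₁ , a₁) (z₂ , hz₂ , x₂ , d₂ , a₂) =
          inj₁ (mkK4Model (_≡ p) D H₁ H₂ (_≟ p) D? H₁? H₂?
            (λ { _ _ refl refl → ε }) (component-connected Off q) c₁ c₂
            (λ { refl d → proj₂ (D⊆Off d) (here refl) })
            (λ { refl h → p∉Outer (H₁⊆ h) }) (λ { refl h → p∉Outer (H₂⊆ h) })
            (λ d h → D∩Outer d (H₁⊆ h)) (λ d h → D∩Outer d (H₂⊆ h)) dis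
            (p , q , refl , ε , p~q) (p , y , refl , hy , p~y) (p , s , refl , h₂s , ~-sym s~p)
            (x₁ , z₁ , d₁ , hz₁ , a₁) (x₂ , z₂ , d₂ , hz₂ , a₂) ad)
          where
          D∩Outer : Disjoint D Outer
          D∩Outer d (inj₁ m) = proj₂ (D⊆Off d) (there m)
          D∩Outer d (inj₂ (inj₁ w)) = U∩W (proj₁ (D⊆Off d)) w
          D∩Outer d (inj₂ (inj₂ refl)) = s∉U (proj₁ (D⊆Off d))

        -- With no attachment on the path beyond `p`, `D` can meet the cycle only at `s` and in `W`,
        -- and there only at `t`. So the cycle is cut between `W` and `s`.
        atEnd : (∀ z → z ∈ ps → ¬ Att z) → ∃ (λ y → (y ∈ ps ⊎ W y) × p ~ y) →
          IsConnected (λ z → z ∈ ps ⊎ W z) → Result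
        atEnd none (y , hy , p~y) conn with any? (λ z → W? z ×-dec Att? z) | Att? s
        ... | yes (w , ww , aw) | yes as = k4 (λ z → z ∈ ps ⊎ W z) (_≡ s) (λ x → (x ∈? ps) ⊎-dec W? x) (_≟ s)
            conn (λ { _ _ refl refl → ε }) [ inj₁ , inj₂ ∘ inj₁ ]′ (inj₂ ∘ inj₂)
            (λ { (inj₁ m) refl → s∉U (∈ps⇒U m) ; (inj₂ w) refl → s∉W w })
            (let w , ww , s~w = bypass in w , s , inj₂ ww , refl , ~-sym s~w)
            (y , hy , p~y) refl (w , inj₂ ww , aw) (s , refl , as)
        ... | yes (w , ww , x , d , x~w) | no ¬as = smaller t (inj₂ (inj₁ t∈W)) λ where
            z (inj₁ m) az → contradiction az (none z m)
            z (inj₂ (inj₁ wz)) (x , d , x~z) → onlyT (proj₁ (D⊆Off d)) wz x~z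
            z (inj₂ (inj₂ refl)) az → contradiction az ¬as
          where
          onlyT : ∀ {x z} → U x → W z → x ~ z → z ≡ t
          onlyT ux wz x~z with boundary ux x~z
          ... | inj₁ uz = ⊥-elim (U∩W uz wz)
          ... | inj₂ (inj₁ refl) = contradiction wz s∉W
          ... | inj₂ (inj₂ e) = e
        ... | no ¬aw | _ = smaller s (inj₂ (inj₂ refl)) λ where
            z (inj₁ m) az → contradiction az (none z m)
            z (inj₂ (inj₁ wz)) az → contradiction (z , wz , az) ¬aw
            z (inj₂ (inj₂ e)) az → e

        -- H is the part of ps up to and including x.
        scan : ∀ {H x zs} → Decidable H → InducedPath x zs → H x → IsConnected H →
          (∀ {z} → H z → z ∈ ps × z ∉ zs) → (∀ {z} → z ∈ zs → z ∈ ps) →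
          (∀ {z} → z ∈ ps → H z ⊎ z ∈ zs) →
          ∃ (λ y → H y × p ~ y) → (∀ {z} → H z → z ≢ x → ¬ Att z) → Result
        scan {H} {x} {zs} H? Q hx H-conn H⊆ zs⊆ cover (y , hy , p~y) none with Att? x
        -- `x` is the first attachment on the path, so the cycle is cut just after it. If nothing
        -- further on is attached, `p` and `x` separate `D`.
        ... | yes ax with any? (λ z → ((z ∈? zs) ⊎-dec W? z ⊎-dec z ≟ s) ×-dec Att? z)
        ...   | yes (z , h₂z , az) = k4 H _ H? (λ z → (z ∈? zs) ⊎-dec W? z ⊎-dec z ≟ s)
                  H-conn (suffix-connected Q) (inj₁ ∘ proj₁ ∘ H⊆) [ inj₁ ∘ zs⊆ , inj₂ ]′
                  (λ { h (inj₁ m) → proj₂ (H⊆ h) m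
                     ; h (inj₂ (inj₁ w)) → U∩W (∈ps⇒U (proj₁ (H⊆ h))) w
                     ; h (inj₂ (inj₂ refl)) → s∉U (∈ps⇒U (proj₁ (H⊆ h))) })
                  (next Q) (y , hy , p~y) (inj₂ (inj₂ refl)) (x , hx , ax) (z , h₂z , az)
          where
          next : ∀ {zs} → InducedPath x zs → Adjacent H (λ z → z ∈ zs ⊎ W z ⊎ z ≡ s)
          next (end _ x~t) = x , t , hx , inj₂ (inj₁ t∈W) , x~t
          next (cons _ _ x~y _ _ _) = x , _ , hx , inj₁ (here refl) , x~y
        ...   | no ¬az = smaller x (inj₁ (proj₁ (H⊆ hx))) λ where
                  z (inj₁ m) az → case-H (z ≟ x) az (cover m)
                  z (inj₂ o) az → contradiction (z , inj₂ o , az) ¬az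
          where
          case-H : ∀ {z} → Dec (z ≡ x) → Att z → H z ⊎ z ∈ zs → z ≡ x
          case-H (yes e) _ _ = e
          case-H (no ne) az (inj₁ h) = contradiction az (none h ne)
          case-H {z} (no _) az (inj₂ m) = contradiction (z , inj₁ m , az) ¬az
        scan {H} {x} H? (end ux x~t) hx H-conn H⊆ zs⊆ cover (y , hy , p~y) none | no ¬ax =
          atEnd none′ (y , inj₁ (proj₁ (H⊆ hy)) , p~y) conn′
          where
          inH : ∀ {z} → z ∈ ps → H z
          inH m with cover m
          ... | inj₁ h = h
          none′ : ∀ z → z ∈ ps → ¬ Att z
          none′ z m with z ≟ x
          ... | yes refl = ¬ax
          ... | no ne = none (inH m) ne
          conn′ : IsConnected (λ z → z ∈ ps ⊎ W z)
          conn′ = star-connected x (inj₁ (proj₁ (H⊆ hx))) λ where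
            z (inj₁ m) → Conn-mono (inj₁ ∘ proj₁ ∘ H⊆) (H-conn x z hx (inH m))
            z (inj₂ w) → (x~t , inj₂ t∈W) ◅ Conn-mono inj₂ (W-conn t z t∈W w)
        scan {H} {x} {y′ ∷ zs} H? (cons ux x≁t x~y′ x≢y′ al Q) hx H-conn H⊆ zs⊆ cover (y , hy , p~y) none | no ¬ax =
          scan {λ z → H z ⊎ z ≡ y′} (λ z → H? z ⊎-dec z ≟ y′) Q (inj₂ refl)
            (star-connected x (inj₁ hx) λ where
              z (inj₁ h) → Conn-mono inj₁ (H-conn x z hx h)
              z (inj₂ refl) → (x~y′ , inj₂ refl) ◅ ε)
            (λ { (inj₁ h) → proj₁ (H⊆ h) , proj₂ (H⊆ h) ∘ there
               ; (inj₂ refl) → zs⊆ (here refl) , path-head∉ Q })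
            (zs⊆ ∘ there)
            (λ m → cov (cover m))
            (y , inj₁ hy , p~y)
            (λ { {z} (inj₁ h) ne → none′ h (z ≟ x) ; (inj₂ e) ne → contradiction e ne })
          where
          cov : ∀ {z} → H z ⊎ z ∈ y′ ∷ zs → (H z ⊎ z ≡ y′) ⊎ z ∈ zs
          cov (inj₁ h) = inj₁ (inj₁ h)
          cov (inj₂ (here e)) = inj₁ (inj₂ e)
          cov (inj₂ (there m)) = inj₂ m
          none′ : ∀ {z} → H z → Dec (z ≡ x) → ¬ Att z
          none′ h (yes refl) = ¬ax
          none′ h (no ne) = none h ne

      open Attach using (scan; atEnd)

      attach : ∀ {p ps q} (P : InducedPath p ps) → s ~ p → p ~ q → U q → q ∉ p ∷ ps → K4Model ⊎ Smaller U
      attach P@(end up p~t) s~p p~q uq q∉ = atEnd P s~p p~q uq q∉ (λ _ ()) (t , inj₂ t∈W , p~t)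
        λ { x y (inj₂ wx) (inj₂ wy) → Conn-mono inj₂ (W-conn x y wx wy) }
      attach P@(cons {y = y} up p≁t p~y p≢y al Q) s~p p~q uq q∉ =
        scan P s~p p~q uq q∉ {λ z → z ≡ y} (_≟ y) Q refl (λ { _ _ refl refl → ε })
          (λ { refl → here refl , path-head∉ Q }) there
          (λ { (here e) → inj₁ e ; (there m) → inj₂ m })
          (y , refl , p~y) (λ e ne → contradiction e ne)

      descend : K4Model ⊎ Smaller U
      descend with entry
      ... | u , uu , s~u with any? (λ x → conn? U? u x ×-dec ~? x t)
      ...   | yes (x , r , x~t) =
              let _ , P = inducedPath uu r x~t
                  y , p~y , other = path-next P
                  q , p~q , q≢s , q≢y = deg3 u s y
                  uq , q∉ = other q p~q q≢s q≢y
              in attach P s~u p~q uq q∉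
      -- The component of `u` in `U` has no edge to `t`, so `s` is its only exit. Without `u` it is
      -- a lobe between `u` and `s`, and the edge joining `u` and `s` is the bypass.
      ...   | no ¬r = inj₂ (U′ , u , s , L′ , (λ (r , _) → Conn-end uu r) , u , uu , λ (_ , ne) → ne refl)
        where
        R : V → Set
        R = Conn U u
        U′ : V → Set
        U′ x = R x × x ≢ u
        R-closed : ∀ {x y} → R x → x ~ y → R y ⊎ y ≡ s
        R-closed {x} r x~y with boundary (Conn-end uu r) x~y
        ... | inj₁ uy = inj₁ (r ◅◅ (x~y , uy) ◅ ε)
        ... | inj₂ (inj₁ e) = inj₂ e
        ... | inj₂ (inj₂ refl) = contradiction (x , r , x~y) ¬r
        R≢s : ∀ {x} → R x → x ≢ s
        R≢s r refl = s∉U (Conn-end uu r)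
        bd : ∀ {x y} → U′ x → x ~ y → U′ y ⊎ y ≡ u ⊎ y ≡ s
        bd {y = y} (r , _) x~y with R-closed r x~y | y ≟ u
        ... | inj₂ e | _ = inj₂ (inj₂ e)
        ... | inj₁ _ | yes e = inj₂ (inj₁ e)
        ... | inj₁ ry | no ne = inj₁ (ry , ne)
        third : ∃ λ y → U′ y × u ~ y
        third with deg3 u s s
        ... | y , u~y , y≢s , _ with R-closed ε u~y
        ...   | inj₁ ry = y , (ry , λ { refl → ~-irrefl u~y }) , u~y
        ...   | inj₂ e = contradiction e y≢s
        L′ : Lobe U′ u s
        L′ = record
          { U? = λ x → conn? U? u x ×-dec ¬? (x ≟ u)
          ; W = _≡ s
          ; W? = _≟ s
          ; s∉U = λ (_ , ne) → ne refl
          ; s∉W = R≢s ε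
          ; t∈W = refl
          ; U∩W = λ (r , _) e → R≢s r e
          ; boundary = bd
          ; W-conn = λ { _ _ refl refl → ε }
          ; entry = third
          ; bypass = s , refl , ~-sym s~u
          }

    -- The list `xs` is a finite measure for the predicate `U`: the vertex lost in a descent step is
    -- struck from it.
    search : ∀ k {U s t} → Lobe U s t → (xs : List V) → (∀ {x} → U x → x ∈ xs) → length xs ≤ k → K4Model
    search k L xs bound ≤k with Step.descend L
    search k L xs bound ≤k | inj₁ m = m
    search zero {U} L [] bound ≤k | inj₂ (_ , _ , _ , _ , _ , x , ux , _) with bound ux
    ... | ()
    search (suc k) {U} L xs bound ≤k | inj₂ (U′ , s , t , L′ , sub , x , ux , ¬u′x) =
      search k L′ (filter (λ y → ¬? (y ≟ x)) xs)
        (λ {y} u′ → ∈-filter⁺ (λ y → ¬? (y ≟ x)) (bound (sub u′)) λ { refl → ¬u′x u′ })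
        (s≤s⁻¹ (≤-trans (filter-notAll (λ y → ¬? (y ≟ x)) xs (Any.map (λ e f → f (sym e)) (bound ux))) ≤k))

    -- Any edge starts the descent: its ends are `s` and `t`, all other vertices form `U`, and the
    -- edge itself is the bypass.
    k4Model : V → K4Model
    k4Model v with deg3 v v v
    ... | w , v~w , w≢v , _ = search (length (allFin n)) L (allFin n) (λ _ → ∈-allFin _) ≤-refl
      where
      bd : ∀ {x y} → x ≢ v × x ≢ w → x ~ y → (y ≢ v × y ≢ w) ⊎ y ≡ v ⊎ y ≡ w
      bd {y = y} _ _ with y ≟ v | y ≟ w
      ... | yes e | _ = inj₂ (inj₁ e)
      ... | no _ | yes e = inj₂ (inj₂ e)
      ... | no ne | no ne′ = inj₁ (ne , ne′)
      L : Lobe (λ x → x ≢ v × x ≢ w) v w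
      L = record
        { U? = λ x → ¬? (x ≟ v) ×-dec ¬? (x ≟ w)
        ; W = _≡ w
        ; W? = _≟ w
        ; s∉U = λ (ne , _) → ne refl
        ; s∉W = λ { refl → ~-irrefl v~w }
        ; t∈W = refl
        ; U∩W = λ (_ , ne) e → ne e
        ; boundary = bd
        ; W-conn = λ { _ _ refl refl → ε }
        ; entry = let u , v~u , u≢v , u≢w = deg3 v v w in u , (u≢v , u≢w) , v~u
        ; bypass = w , refl , v~w
        }

-- Series-parallel reduction of spanning trees

src tgt : (G : Multigraph) → Fin (nE G) → Fin (nV G)
src G f = proj₁ (ends G f)
tgt G f = proj₂ (ends G f)

module _ {G : Multigraph} {A : Fin (nE G) → Set} where

  incident-sym : ∀ {f u v} → Incident G f u v → Incident G f v u
  incident-sym (inj₁ p) = inj₂ p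
  incident-sym (inj₂ p) = inj₁ p

  reach-trans : ∀ {u v w} → Reach G A u v → Reach G A v w → Reach G A u w
  reach-trans here q = q
  reach-trans (step f a i p) q = step f a i (reach-trans p q)

  reach-edge : ∀ {u v} f → A f → Incident G f u v → Reach G A u v
  reach-edge f a i = step f a i here

  reach-sym : ∀ {u v} → Reach G A u v → Reach G A v u
  reach-sym here = here
  reach-sym (step f a i p) = reach-trans (reach-sym p) (reach-edge f a (incident-sym i))

  reach-≡ : ∀ {u v} → u ≡ v → Reach G A u v
  reach-≡ refl = here

-- An edge may become a whole walk, possibly empty, so that detours, exchanges and collapsed edges
-- are all covered.
reach-map : ∀ {G H A B} (π : Fin (nV G) → Fin (nV H)) →
  (∀ f → A f → Reach H B (π (src G f)) (π (tgt G f))) →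
  ∀ {u v} → Reach G A u v → Reach H B (π u) (π v)
reach-map π φ here = here
reach-map {G} π φ (step f a (inj₁ p) w) =
  reach-trans (subst₂ (λ x y → Reach _ _ (π x) (π y)) (cong proj₁ p) (cong proj₂ p) (φ f a)) (reach-map π φ w)
reach-map {G} π φ (step f a (inj₂ p) w) =
  reach-trans (reach-sym (subst₂ (λ x y → Reach _ _ (π x) (π y)) (cong proj₁ p) (cong proj₂ p) (φ f a))) (reach-map π φ w)

punchIn-view : ∀ {k} (g f : Fin (suc k)) → f ≡ g ⊎ ∃ λ j → f ≡ punchIn g j
punchIn-view g f with g ≟ f
... | yes p = inj₁ (sym p)
... | no ne = inj₂ (punchOut ne , sym (punchIn-punchOut ne))

-- Deletion and contraction of an edge

record Contraction {m : ℕ} (u v : Fin m) : Set where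
  field
    size  : ℕ
    π     : Fin m → Fin size
    glue  : π u ≡ π v
    fibre : ∀ a b → π a ≡ π b → a ≡ b ⊎ (a ≡ u × b ≡ v) ⊎ (a ≡ v × b ≡ u)
    onto  : ∀ j → ∃ λ a → π a ≡ j

contraction : ∀ {m} (u v : Fin m) → u ≢ v → Contraction u v
contraction {suc m} u v u≢v = record
  { size = m ; π = π ; glue = trans (π-≢ u (≢-sym u≢v)) (sym π-v) ; fibre = fibre
  ; onto = λ j → punchIn v j , trans (π-≢ _ (≢-sym (punchInᵢ≢i v j)))
                                  (trans (punchOut-cong v refl) (punchOut-punchIn v)) }
  where
  π′ : ∀ w → Dec (v ≡ w) → Fin m
  π′ w (yes _) = punchOut (≢-sym u≢v)
  π′ w (no ne) = punchOut ne
  π : Fin (suc m) → Fin m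
  π w = π′ w (v ≟ w)
  π-v : π v ≡ punchOut (≢-sym u≢v)
  π-v with v ≟ v
  ... | yes _ = refl
  ... | no ne = contradiction refl ne
  π-≢ : ∀ w (ne : v ≢ w) → π w ≡ punchOut ne
  π-≢ w ne with v ≟ w
  ... | yes e = contradiction e ne
  ... | no _ = punchOut-cong v refl
  fibre : ∀ a b → π a ≡ π b → a ≡ b ⊎ (a ≡ u × b ≡ v) ⊎ (a ≡ v × b ≡ u)
  fibre a b p with v ≟ a | v ≟ b
  ... | yes e | yes e′ = inj₁ (trans (sym e) e′)
  ... | yes e | no ne  = inj₂ (inj₂ (sym e , sym (punchOut-injective {i = v} _ _ p)))
  ... | no ne | yes e  = inj₂ (inj₁ (punchOut-injective {i = v} _ _ p , sym e))
  ... | no ne | no ne′ = inj₁ (punchOut-injective {i = v} _ _ p)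

graph : ∀ {m k} → (Fin k → Fin m × Fin m) → Multigraph
graph {m} {k} en = record { nV = m ; nE = k ; ends = en }

module _ {m k : ℕ} (en : Fin (suc k) → Fin m × Fin m) (g : Fin (suc k)) where

  private
    G : Multigraph
    G = graph en

  delete : Multigraph
  delete = graph (en ∘ punchIn g)

  lookup-punchIn : ∀ {b x j} → lookup (insertAt x g b) (punchIn g j) ≡ true → lookup x j ≡ true
  lookup-punchIn {b} {x} {j} = trans (sym (insertAt-punchIn x g b j))

  lookup-punchIn⁻ : ∀ {b x j} → lookup x j ≡ true → lookup (insertAt x g b) (punchIn g j) ≡ true
  lookup-punchIn⁻ {b} {x} {j} = trans (insertAt-punchIn x g b j)

  -- Each use of `g` is replaced by a detour, which is owed only if `A` admits `g`.
  delete-reach : ∀ {A B} → (∀ j → A (punchIn g j) → B j) → (A g → Reach delete B (src G g) (tgt G g)) →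
    ∀ {u v} → Reach G A u v → Reach delete B u v
  delete-reach {A} {B} f h = reach-map {G} {delete} id λ i → go i (punchIn-view g i)
    where
    go : ∀ i → i ≡ g ⊎ (∃ λ j → i ≡ punchIn g j) → A i → Reach delete B (src G i) (tgt G i)
    go i (inj₁ refl) a = h a
    go i (inj₂ (j , refl)) a = reach-edge j (f j a) (inj₁ refl)

  delete-reach⁻ : ∀ {A B} → (∀ j → A j → B (punchIn g j)) → ∀ {u v} → Reach delete A u v → Reach G B u v
  delete-reach⁻ f = reach-map id λ j a → reach-edge (punchIn g j) (f j a) (inj₁ refl)

  delete-tree : ∀ {x} → X G (insertAt x g false) → X delete x
  delete-tree {x} (conn , acyc) =
    (λ u v → delete-reach (λ _ → lookup-punchIn {false} {x}) (λ a → contradiction (trans (sym a) (insertAt-lookup x g false)) λ ()) (conn u v)) ,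
    (λ j a w → acyc (punchIn g j) (lookup-punchIn⁻ {false} {x} a)
      (delete-reach⁻ (λ i (b , ne) → lookup-punchIn⁻ {false} {x} b , ne ∘ punchIn-injective g i j) w))

  delete-minor : K4Minor delete → K4Minor G
  delete-minor M = record
    { B = B ; disjoint = disjoint ; nonempty = nonempty
    ; conn = λ i u v a b → delete-reach⁻ (λ _ → id) (conn i u v a b)
    ; adj = λ i j ne → let f , p = adj i j ne in punchIn g f , p }
    where open K4Minor M

  delete-connected : Reach delete (λ _ → ⊤) (src G g) (tgt G g) → Connected G → Connected delete
  delete-connected r (nz , c) = nz , λ u v → delete-reach _ (λ _ → r) (c u v)

  module _ (C : Contraction (src G g) (tgt G g)) where
    open Contraction C

    contract : Multigraph
    contract = graph (λ j → π (proj₁ (en (punchIn g j))) , π (proj₂ (en (punchIn g j))))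

    contract-reach : ∀ {A B} → (∀ j → A (punchIn g j) → B j) →
      ∀ {u v} → Reach G A u v → Reach contract B (π u) (π v)
    contract-reach {A} {B} f = reach-map {G} {contract} π λ i → go i (punchIn-view g i)
      where
      go : ∀ i → i ≡ g ⊎ (∃ λ j → i ≡ punchIn g j) → A i → Reach contract B (π (src G i)) (π (tgt G i))
      go i (inj₁ refl) a = reach-≡ glue
      go i (inj₂ (j , refl)) a = reach-edge j (f j a) (inj₁ refl)

    fibre-reach : ∀ {A a b} → π a ≡ π b → (π a ≡ π (src G g) → A g) → Reach G A a b
    fibre-reach {A} {a} {b} p h with fibre a b p
    ... | inj₁ refl = here
    ... | inj₂ (inj₁ (refl , refl)) = reach-edge g (h refl) (inj₁ refl)
    ... | inj₂ (inj₂ (refl , refl)) = reach-edge g (h (sym glue)) (inj₂ refl)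

    -- A walk is lifted by inserting `g` where it passes the glued vertex. The invariant `P` of the
    -- visited vertices is there for branch sets, inside which `g` may be used only if they contain
    -- the glued vertex.
    contract-reach⁻ : ∀ {A B} (P : Fin size → Set) →
      (∀ j → A j → B (punchIn g j) × P (src contract j) × P (tgt contract j)) →
      (P (π (src G g)) → B g) →
      ∀ {x y} → P x → Reach contract A x y → ∀ {a b} → π a ≡ x → π b ≡ y → Reach G B a b
    contract-reach⁻ P f h px here refl q = fibre-reach (sym q) λ r → h (subst P r px)
    contract-reach⁻ P f h px (step j aj (inj₁ e) w) {a} refl q =
      let b , ps , pt = f j aj in
      reach-trans (fibre-reach {a = a} (sym (cong proj₁ e)) λ r → h (subst P r px))
        (step (punchIn g j) b (inj₁ refl)
          (contract-reach⁻ P f h (subst P (cong proj₂ e) pt) w (cong proj₂ e) q))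
    contract-reach⁻ P f h px (step j aj (inj₂ e) w) {a} refl q =
      let b , ps , pt = f j aj in
      reach-trans (fibre-reach {a = a} (sym (cong proj₂ e)) λ r → h (subst P r px))
        (step (punchIn g j) b (inj₂ refl)
          (contract-reach⁻ P f h (subst P (cong proj₁ e) ps) w (cong proj₁ e) q))

    contract-tree : ∀ {x} → X G (insertAt x g true) → X contract x
    contract-tree {x} (conn , acyc) = conn′ , λ j a w → acyc (punchIn g j) (lookup-punchIn⁻ {true} {x} a)
      (contract-reach⁻ (λ _ → ⊤) (λ i (b , ne) → (lookup-punchIn⁻ {true} {x} b , ne ∘ punchIn-injective g i j) , tt , tt)
        (λ _ → insertAt-lookup x g true , ≢-sym (punchInᵢ≢i g j)) tt w refl refl)
      where
      conn′ : ∀ u v → Reach contract (InT contract x) u v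
      conn′ u v with onto u | onto v
      ... | a , refl | b , refl = contract-reach (λ _ → lookup-punchIn {true} {x}) (conn a b)

    contract-connected : Connected G → Connected contract
    contract-connected (_ , c) = nz (π (src G g)) , conn′
      where
      nz : ∀ {n} → Fin n → NonZero n
      nz zero = _
      nz (suc _) = _
      conn′ : ∀ u v → Reach contract (λ _ → ⊤) u v
      conn′ u v with onto u | onto v
      ... | a , refl | b , refl = contract-reach _ (c a b)

    contract-minor : K4Minor contract → K4Minor G
    contract-minor M = record
      { B = λ i a → B i (π a)
      ; disjoint = λ i j v → disjoint i j (π v)
      ; nonempty = λ i → let v , p = nonempty i ; a , q = onto v in a , trans (cong (B i) q) p
      ; conn = λ i u v a b → contract-reach⁻ (λ x → B i x ≡ true) (λ _ p → p , p)
                 (λ p → p , trans (cong (B i) (sym glue)) p) a (conn i (π u) (π v) a b) refl refl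
      ; adj = λ i j ne → let f , p = adj i j ne in punchIn g f , p }
      where open K4Minor M

-- Exchanging two parallel edges or two edges in series

module _ {m k : ℕ} (en : Fin (suc (suc k)) → Fin m × Fin m)
  (g : Fin (suc (suc k))) (f : Fin (suc k)) where

  private
    G : Multigraph
    G = graph en
    f′ : Fin (suc (suc k))
    f′ = punchIn g f

  pair : Bool → Bool → Vec Bool k → Vec Bool (suc (suc k))
  pair p q x = insertAt (insertAt x f q) g p

  pair-g : ∀ {p q x} → lookup (pair p q x) g ≡ p
  pair-g {p} {q} {x} = insertAt-lookup (insertAt x f q) g p

  pair-f : ∀ {p q x} → lookup (pair p q x) f′ ≡ q
  pair-f {p} {q} {x} = trans (insertAt-punchIn (insertAt x f q) g p f) (insertAt-lookup x f q)

  pair-other : ∀ {p q x h} → h ≢ g → h ≢ f′ → ∀ {p′ q′} → lookup (pair p q x) h ≡ true → lookup (pair p′ q′ x) h ≡ true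
  pair-other {p} {q} {x} {h} h≢g h≢f {p′} {q′} a with punchIn-view g h
  ... | inj₁ e = contradiction e h≢g
  ... | inj₂ (j , refl) with punchIn-view f j
  ...   | inj₁ refl = contradiction refl h≢f
  ...   | inj₂ (i , refl) = trans (val p′ q′) (trans (sym (val p q)) a)
    where
    val : ∀ p q → lookup (pair p q x) (punchIn g (punchIn f i)) ≡ lookup x i
    val p q = trans (insertAt-punchIn (insertAt x f q) g p (punchIn f i)) (insertAt-punchIn x f q i)

  swap-parallel : Incident G f′ (src G g) (tgt G g) → ∀ {x} → X G (pair true false x) → X G (pair false true x)
  swap-parallel par {x} (conn , acyc) =
    (λ u v → reach-map id (λ h a → conn-edge h a (h ≟ g) (h ≟ f′)) (conn u v)) ,
    (λ h a w → acyclic h a w (h ≟ g) (h ≟ f′))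
    where
    T = pair true false x
    T′ = pair false true x
    conn-edge : ∀ h → InT G T h → Dec (h ≡ g) → Dec (h ≡ f′) → Reach G (InT G T′) (src G h) (tgt G h)
    conn-edge h a (yes refl) _ = reach-edge f′ (pair-f {false} {true} {x}) par
    conn-edge h a (no _) (yes refl) = contradiction (trans (sym a) (pair-f {true} {false} {x})) λ ()
    conn-edge h a (no ne) (no ne′) = reach-edge h (pair-other {true} {false} {x} ne ne′ a) (inj₁ refl)
    acyclic : ∀ h → InT G T′ h → Reach G (λ i → InT G T′ i × i ≢ h) (src G h) (tgt G h) →
      Dec (h ≡ g) → Dec (h ≡ f′) → ⊥
    acyclic h a w (yes refl) _ = contradiction (trans (sym a) (pair-g {false} {true} {x})) λ ()
    acyclic h a w (no _) (yes refl) = acyc g (pair-g {true} {false} {x}) (close par w′)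
      where
      edge : ∀ i → Dec (i ≡ g) → InT G T′ i × i ≢ f′ → Reach G (λ i → InT G T i × i ≢ g) (src G i) (tgt G i)
      edge i (yes refl) (b , _) = contradiction (trans (sym b) (pair-g {false} {true} {x})) λ ()
      edge i (no ne) (b , ne′) = reach-edge i (pair-other {false} {true} {x} ne ne′ b , ne) (inj₁ refl)
      w′ : Reach G (λ i → InT G T i × i ≢ g) (src G f′) (tgt G f′)
      w′ = reach-map id (λ i → edge i (i ≟ g)) w
      close : ∀ {B u v} → Incident G f′ u v → Reach G B (src G f′) (tgt G f′) → Reach G B u v
      close (inj₁ e) r = subst₂ (Reach G _) (cong proj₁ e) (cong proj₂ e) r
      close (inj₂ e) r = reach-sym (subst₂ (Reach G _) (cong proj₁ e) (cong proj₂ e) r)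
    acyclic h a w (no ne) (no ne′) = acyc h (pair-other {false} {true} {x} ne ne′ a) (reach-map id (λ i b → edge i b (i ≟ g) (i ≟ f′)) w)
      where
      edge : ∀ i → InT G T′ i × i ≢ h → Dec (i ≡ g) → Dec (i ≡ f′) → Reach G (λ i → InT G T i × i ≢ h) (src G i) (tgt G i)
      edge i (b , _) (yes refl) _ = contradiction (trans (sym b) (pair-g {false} {true} {x})) λ ()
      edge i (b , _) (no _) (yes refl) = reach-sym (reach-edge g (pair-g {true} {false} {x} , ≢-sym ne) (flip′ par))
        where
        flip′ : Incident G f′ (src G g) (tgt G g) → Incident G g (tgt G f′) (src G f′)
        flip′ (inj₁ e) = inj₂ (sym e)
        flip′ (inj₂ e) = inj₁ (cong₂ _,_ (sym (cong proj₂ e)) (sym (cong proj₁ e)))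
      edge i (b , i≢h) (no n₁) (no n₂) = reach-edge i (pair-other {false} {true} {x} n₁ n₂ b , i≢h) (inj₁ refl)

  record SeriesAt (v : Fin m) : Set where
    field
      u w  : Fin m
      u≢v  : u ≢ v
      w≢v  : w ≢ v
      g-at : Incident G g v u
      f-at : Incident G f′ v w
      only : ∀ h y → Incident G h v y → h ≡ g ⊎ h ≡ f′

  -- In the old tree `v` is a leaf hung on `w`, in the new one a leaf hung on `u`. The map `push z`
  -- moves `v` to its neighbour `z` and collapses the edge between them, so pushed walks stay in the
  -- part common to both trees.
  swap-series : ∀ {v} → SeriesAt v → ∀ {x} → X G (pair false true x) → X G (pair true false x)
  swap-series {v} S {x} (conn , acyc) = conn′ , λ h a r → acyclic h a r (h ≟ g) (h ≟ f′)
    where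
    open SeriesAt S
    T = pair false true x
    T′ = pair true false x
    push : Fin m → Fin m → Fin m
    push z y with y ≟ v
    ... | yes _ = z
    ... | no _ = y
    push-v : ∀ z → push z v ≡ z
    push-v z with v ≟ v
    ... | yes _ = refl
    ... | no ne = contradiction refl ne
    push-≢ : ∀ z {y} → y ≢ v → push z y ≡ y
    push-≢ z {y} ne with y ≟ v
    ... | yes e = contradiction e ne
    ... | no _ = refl
    collapse : ∀ {h z} → z ≢ v → Incident G h v z → push z (src G h) ≡ push z (tgt G h)
    collapse {h} {z} ne (inj₁ e) rewrite e = trans (push-v z) (sym (push-≢ z ne))
    collapse {h} {z} ne (inj₂ e) rewrite e = trans (push-≢ z ne) (sym (push-v z))
    away : ∀ {h} → h ≢ g → h ≢ f′ → src G h ≢ v × tgt G h ≢ v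
    away {h} n₁ n₂ =
      (λ { e → [ n₁ , n₂ ]′ (only h (tgt G h) (inj₁ (cong (_, tgt G h) e))) }) ,
      (λ { e → [ n₁ , n₂ ]′ (only h (src G h) (inj₂ (cong (src G h ,_) e))) })
    keep : ∀ z {h B} → h ≢ g → h ≢ f′ → B h → Reach G B (push z (src G h)) (push z (tgt G h))
    keep z {h} n₁ n₂ b with away n₁ n₂
    ... | s≢v , t≢v = subst₂ (Reach G _) (sym (push-≢ z s≢v)) (sym (push-≢ z t≢v)) (reach-edge h b (inj₁ refl))
    conn-edge : ∀ h → InT G T h → Dec (h ≡ g) → Dec (h ≡ f′) → Reach G (InT G T′) (push w (src G h)) (push w (tgt G h))
    conn-edge h a (yes refl) _ = contradiction (trans (sym a) (pair-g {false} {true} {x})) λ ()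
    conn-edge h a (no _) (yes refl) = reach-≡ (collapse w≢v f-at)
    conn-edge h a (no n₁) (no n₂) = keep w n₁ n₂ (pair-other {false} {true} {x} n₁ n₂ a)
    push-u≢v : ∀ a → push u a ≢ v
    push-u≢v a with a ≟ v
    ... | yes _ = u≢v
    ... | no ne = ne
    to-push : ∀ a → Reach G (InT G T′) a (push u a)
    to-push a with a ≟ v
    ... | yes refl = reach-edge g (pair-g {true} {false} {x}) g-at
    ... | no _ = here
    conn′ : ∀ a b → Reach G (InT G T′) a b
    -- An end at `v` first moves to `u` along `g`. The old walk between the new ends is then pushed
    -- to `w`, which collapses the missing edge `f′`.
    conn′ a b = reach-trans (to-push a) (reach-trans
      (subst₂ (Reach G _) (push-≢ w (push-u≢v a)) (push-≢ w (push-u≢v b))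
        (reach-map (push w) (λ h i → conn-edge h i (h ≟ g) (h ≟ f′)) (conn (push u a) (push u b))))
      (reach-sym (to-push b)))
    -- `g` is the only edge of the new tree at `v`, so it lies on no cycle.
    stuck : ∀ {z} → z ≢ v → ¬ Reach G (λ i → InT G T′ i × i ≢ g) v z
    stuck ne here = ne refl
    stuck ne (step h (a , h≢g) i _) with only h _ i
    ... | inj₁ e = h≢g e
    ... | inj₂ refl = contradiction (trans (sym a) (pair-f {true} {false} {x})) λ ()
    acyclic : ∀ h → InT G T′ h → Reach G (λ i → InT G T′ i × i ≢ h) (src G h) (tgt G h) →
      Dec (h ≡ g) → Dec (h ≡ f′) → ⊥
    acyclic h a r (no _) (yes refl) = contradiction (trans (sym a) (pair-f {true} {false} {x})) λ ()
    acyclic h a r (yes refl) _ = at g-at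
      where
      at : Incident G g v u → ⊥
      at (inj₁ e) = stuck u≢v (subst₂ (Reach G _) (cong proj₁ e) (cong proj₂ e) r)
      at (inj₂ e) = stuck u≢v (reach-sym (subst₂ (Reach G _) (cong proj₁ e) (cong proj₂ e) r))
    acyclic h a r (no n₁) (no n₂) with away n₁ n₂
    ... | s≢v , t≢v = acyc h (pair-other {true} {false} {x} n₁ n₂ a)
        (subst₂ (Reach G _) (push-≢ u s≢v) (push-≢ u t≢v) (reach-map (push u) (λ i b → edge i b (i ≟ g) (i ≟ f′)) r))
      where
      edge : ∀ i → InT G T′ i × i ≢ h → Dec (i ≡ g) → Dec (i ≡ f′) →
        Reach G (λ i → InT G T i × i ≢ h) (push u (src G i)) (push u (tgt G i))
      edge i (b , _) (yes refl) _ = reach-≡ (collapse u≢v g-at)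
      edge i (b , _) (no _) (yes refl) = contradiction (trans (sym b) (pair-f {true} {false} {x})) λ ()
      edge i (b , ne) (no m₁) (no m₂) = keep u m₁ m₂ (pair-other {true} {false} {x} m₁ m₂ b , ne)

-- The last two constructors leave out coordinate g of X; in merge, f is the coordinate of
-- X′ that g is merged with, and coordinate punchIn g f of X.
data Reducible : ∀ {d} → (Vec Bool d → Set) → Set₁ where
  base  : ∀ {X : Vec Bool 0 → Set} → Reducible X
  fix   : ∀ {d} {X : Vec Bool (suc d) → Set} {X′ : Vec Bool d → Set} g a →
    (∀ b x → X (insertAt x g b) → b ≡ a × X′ x) → Reducible X′ → Reducible X
  merge : ∀ {d} {X : Vec Bool (suc (suc d)) → Set} {X′ : Vec Bool (suc d) → Set} g f a →
    (∀ p q x → X (insertAt (insertAt x f q) g p) →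
      (p ≡ a × X′ (insertAt x f q)) ⊎ (q ≡ a × X′ (insertAt x f p))) →
    Reducible X′ → Reducible X

-- Existence of a reduction

data Reduction {m k} (en : Fin (suc k) → Fin m × Fin m) : Set where
  loop     : ∀ g → proj₁ (en g) ≡ proj₂ (en g) → Reduction en
  parallel : ∀ g f → f ≢ g → Incident (graph en) f (proj₁ (en g)) (proj₂ (en g)) → Reduction en
  pendant  : ∀ g v u → u ≢ v → Incident (graph en) g v u →
    (∀ h y → Incident (graph en) h v y → h ≡ g) → Reduction en
  series   : ∀ g f v u w → f ≢ g → u ≢ v → w ≢ v → Incident (graph en) g v u → Incident (graph en) f v w →
    (∀ h y → Incident (graph en) h v y → h ≡ g ⊎ h ≡ f) → Reduction en

every-or-some : ∀ {m} {P Q : Fin m → Set} → (∀ i → P i ⊎ Q i) → (∃ P) ⊎ (∀ i → Q i)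
every-or-some {zero} h = inj₂ λ ()
every-or-some {suc m} h with h zero | every-or-some (h ∘ suc)
... | inj₁ p | _ = inj₁ (zero , p)
... | inj₂ q | inj₁ (i , p) = inj₁ (suc i , p)
... | inj₂ q | inj₂ f = inj₂ λ { zero → q ; (suc i) → f i }

module _ {m k : ℕ} (en : Fin (suc k) → Fin m × Fin m) where

  private
    G : Multigraph
    G = graph en

  incident? : ∀ f u v → Dec (Incident G f u v)
  incident? f u v = map′
      [ (λ (p , q) → inj₁ (cong₂ _,_ p q)) , (λ (p , q) → inj₂ (cong₂ _,_ p q)) ]′
      (λ { (inj₁ e) → inj₁ (,-injective e) ; (inj₂ e) → inj₂ (,-injective e) })
      (((src G f ≟ u) ×-dec (tgt G f ≟ v)) ⊎-dec ((src G f ≟ v) ×-dec (tgt G f ≟ u)))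

  _~_ : Fin m → Fin m → Set
  u ~ v = ∃ λ f → Incident G f u v

  ~-sym : ∀ {u v} → u ~ v → v ~ u
  ~-sym (f , i) = f , incident-sym {G} {λ _ → ⊤} i

  open AbstractGraph {m} _~_ ~-sym (λ u v → any? λ f → incident? f u v)

  minor : K4Model → K4Minor G
  minor M = record
    { B = λ i v → ⌊ B? i v ⌋
    ; disjoint = λ i j v p q → disjoint i j v (from i v p) (from j v q)
    ; nonempty = λ i → let v , p = nonempty i in v , to i v p
    ; conn = λ i u v p q → walk i (from i u p) (conn i u v (from i u p) (from i v q))
    ; adj = λ i j ne → edge i j (adj i j ne) }
    where
    open K4Model M
    from : ∀ i v → ⌊ B? i v ⌋ ≡ true → B i v
    from i v p with B? i v
    ... | yes b = b
    to : ∀ i v → B i v → ⌊ B? i v ⌋ ≡ true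
    to i v b with B? i v
    ... | yes _ = refl
    ... | no ¬b = contradiction b ¬b
    walk : ∀ i {u v} → B i u → Conn (B i) u v →
      Reach G (λ f → (⌊ B? i (src G f) ⌋ ≡ true) × (⌊ B? i (tgt G f) ⌋ ≡ true)) u v
    walk i bu ε = here
    walk i bu (((f , inj₁ refl) , b) ◅ w) = step f (to i _ bu , to i _ b) (inj₁ refl) (walk i b w)
    walk i bu (((f , inj₂ refl) , b) ◅ w) = step f (to i _ b , to i _ bu) (inj₂ refl) (walk i b w)
    edge : ∀ i j → Adjacent (B i) (B j) → ∃ λ f →
      ((⌊ B? i (src G f) ⌋ ≡ true) × (⌊ B? j (tgt G f) ⌋ ≡ true)) ⊎
      ((⌊ B? j (src G f) ⌋ ≡ true) × (⌊ B? i (tgt G f) ⌋ ≡ true))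
    edge i j (x , y , bx , by , f , inj₁ refl) = f , inj₁ (to i x bx , to j y by)
    edge i j (x , y , bx , by , f , inj₂ refl) = f , inj₂ (to j y by , to i x bx)

  module _ (conn : ∀ u v → Reach G (λ _ → ⊤) u v) (no-loop : ∀ g → src G g ≢ tgt G g)
    (simple : ∀ {g f u v} → Incident G g u v → Incident G f u v → f ≡ g) where

    incident-≢ : ∀ {f u v} → Incident G f u v → u ≢ v
    incident-≢ {f} (inj₁ p) q = no-loop f (trans (cong proj₁ p) (trans q (sym (cong proj₂ p))))
    incident-≢ {f} (inj₂ p) q = no-loop f (trans (cong proj₁ p) (trans (sym q) (sym (cong proj₂ p))))

    some-neighbour : ∀ v → ∃ λ f → ∃ (Incident G f v)
    some-neighbour v = first (other v)
      where
      other : ∀ v → ∃ λ u → u ≢ v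
      -- Edge `zero` is not a loop, so one of its ends differs from `v`.
      other v with src G zero ≟ v
      ... | no ne = _ , ne
      ... | yes refl = tgt G zero , ≢-sym (no-loop zero)
      first : (∃ λ u → u ≢ v) → ∃ λ f → ∃ (Incident G f v)
      first (u , u≢v) with conn v u
      ... | here = contradiction refl u≢v
      ... | step f _ i _ = f , _ , i

    Deg3 : Fin m → Set
    Deg3 v = ∀ a b → ∃ λ w → v ~ w × w ≢ a × w ≢ b

    -- Pigeonhole: simplicity makes the three other ends distinct, and `a` and `b` exclude at most
    -- two of them.
    deg3-from-edges : ∀ {v} {f g h : Fin (suc k)} {x y z} → Incident G f v x → Incident G g v y → Incident G h v z →
      g ≢ f → h ≢ f → h ≢ g → Deg3 v
    deg3-from-edges {v} {f} {g} {h} {x} {y} {z} i j l g≢f h≢f h≢g a b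
      with x ≟ a | x ≟ b | y ≟ a | y ≟ b | z ≟ a | z ≟ b
    ... | no p | no q | _ | _ | _ | _ = x , (f , i) , p , q
    ... | _ | _ | no p | no q | _ | _ = y , (g , j) , p , q
    ... | _ | _ | _ | _ | no p | no q = z , (h , l) , p , q
    ... | yes refl | _ | yes refl | _ | _ | _ = contradiction (simple i j) g≢f
    ... | yes refl | _ | _ | _ | yes refl | _ = contradiction (simple i l) h≢f
    ... | _ | _ | yes refl | _ | yes refl | _ = contradiction (simple j l) h≢g
    ... | _ | yes refl | _ | yes refl | _ | _ = contradiction (simple i j) g≢f
    ... | _ | yes refl | _ | _ | _ | yes refl = contradiction (simple i l) h≢f
    ... | _ | _ | _ | yes refl | _ | yes refl = contradiction (simple j l) h≢g

    reduce-at : ∀ v → Reduction en ⊎ Deg3 v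
    reduce-at v with some-neighbour v
    ... | f , x , i with any? (λ g → ¬? (g ≟ f) ×-dec any? (incident? g v))
    ...   | no none = inj₁ (pendant f v x (≢-sym (incident-≢ i)) i
              λ h y l → decidable-stable (h ≟ f) λ ne → none (h , ne , y , l))
    ...   | yes (g , g≢f , y , j) with any? (λ h → ¬? (h ≟ f) ×-dec ¬? (h ≟ g) ×-dec any? (incident? h v))
    ...     | yes (h , h≢f , h≢g , z , l) = inj₂ (deg3-from-edges i j l g≢f h≢f h≢g)
    ...     | no none = inj₁ (series f g v x y g≢f (≢-sym (incident-≢ i)) (≢-sym (incident-≢ j)) i j
              λ h z l → decidable-stable ((h ≟ f) ⊎-dec (h ≟ g)) λ ne → none (h , ne ∘ inj₁ , ne ∘ inj₂ , z , l))

    reduction-simple : SeriesParallel G → Reduction en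
    reduction-simple sp with every-or-some reduce-at
    ... | inj₁ (_ , r) = r
    ... | inj₂ deg3 = contradiction (minor (Search.k4Model (λ (f , i) → incident-≢ i refl) deg3 (src G zero))) sp

  reduction : Connected G → SeriesParallel G → Reduction en
  reduction (_ , conn) sp with any? (λ g → src G g ≟ tgt G g)
  ... | yes (g , e) = loop g e
  ... | no no-loop with any? (λ g → any? λ f → ¬? (f ≟ g) ×-dec incident? f (src G g) (tgt G g))
  ...   | yes (g , f , ne , i) = parallel g f ne i
  ...   | no none = reduction-simple conn (λ g e → no-loop (g , e))
            (λ {g} {f} i j → decidable-stable (f ≟ g) λ ne → none (g , f , ne , transfer i j)) sp
    where
    transfer : ∀ {g f u v} → Incident G g u v → Incident G f u v → Incident G f (src G g) (tgt G g)
    transfer (inj₁ refl) j = j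
    transfer (inj₂ refl) j = incident-sym {G} {λ _ → ⊤} j

  incident-src≢tgt : ∀ {g v u} → Incident G g v u → u ≢ v → src G g ≢ tgt G g
  incident-src≢tgt (inj₁ refl) ne = ≢-sym ne
  incident-src≢tgt (inj₂ refl) ne = ne

-- A loop lies in no spanning tree and a pendant edge in every one, so their coordinates are
-- constant. For a parallel or series pair, the exchange lemma lets one minor, `g` deleted or
-- contracted, serve both alternatives of `merge`.
reducible-step : ∀ {m k} (en : Fin (suc k) → Fin m × Fin m) → Connected (graph en) → SeriesParallel (graph en) →
  (∀ {m′} (en′ : Fin k → Fin m′ × Fin m′) → Connected (graph en′) → SeriesParallel (graph en′) → Reducible (X (graph en′))) →
  Reduction en → Reducible (X (graph en))
reducible-step {k = k} en c sp ih (loop g e) =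
  fix g false (λ { true x (_ , acyc) → contradiction (reach-≡ e) (acyc g (insertAt-lookup x g true))
                 ; false x t → refl , delete-tree en g t })
    (ih _ (delete-connected en g (reach-≡ e) c) (sp ∘ delete-minor en g))
reducible-step {k = k} en c sp ih (pendant g v u u≢v i only) =
  fix g true (λ { false x (conn , _) → contradiction (conn v u) (stuck x)
                ; true x t → refl , contract-tree en g C t })
    (ih _ (contract-connected en g C c) (sp ∘ contract-minor en g C))
  where
  C = contraction _ _ (incident-src≢tgt en i u≢v)
  stuck : ∀ x → ¬ Reach (graph en) (InT (graph en) (insertAt x g false)) v u
  stuck x here = u≢v refl
  stuck x (step h a j _) with only h _ j
  ... | refl = contradiction (trans (sym a) (insertAt-lookup x g false)) λ ()
reducible-step {k = suc k} en c sp ih (parallel g f f≢g par) with punchIn-view g f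
... | inj₁ e = contradiction e f≢g
... | inj₂ (j , refl) = merge g j false merged
    (ih _ (delete-connected en g (reach-edge j tt par) c) (sp ∘ delete-minor en g))
  where
  merged : ∀ p q x → X (graph en) (pair en g j p q x) →
    (p ≡ false × X (delete en g) (insertAt x j q)) ⊎ (q ≡ false × X (delete en g) (insertAt x j p))
  merged false q x t = inj₁ (refl , delete-tree en g t)
  merged true false x t = inj₂ (refl , delete-tree en g (swap-parallel en g j par t))
  merged true true x (_ , acyc) = contradiction
    (reach-edge (punchIn g j) (pair-f en g j {true} {true} {x} , punchInᵢ≢i g j) par)
    (acyc g (pair-g en g j {true} {true} {x}))
reducible-step {k = zero} en c sp ih (parallel zero zero f≢g _) = contradiction refl f≢g
reducible-step {k = zero} en c sp ih (series zero zero _ _ _ f≢g _ _ _ _ _) = contradiction refl f≢g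
reducible-step {k = suc k} en c sp ih (series g f v u w f≢g u≢v w≢v i l only) with punchIn-view g f
... | inj₁ e = contradiction e f≢g
... | inj₂ (j , refl) = merge g j true merged
    (ih _ (contract-connected en g C c) (sp ∘ contract-minor en g C))
  where
  C = contraction _ _ (incident-src≢tgt en i u≢v)
  S : SeriesAt en g j v
  S = record { u = u ; w = w ; u≢v = u≢v ; w≢v = w≢v ; g-at = i ; f-at = l ; only = only }
  stuck : ∀ x → ¬ Reach (graph en) (InT (graph en) (pair en g j false false x)) v u
  stuck x here = u≢v refl
  stuck x (step h a y _) with only h _ y
  ... | inj₁ refl = contradiction (trans (sym a) (pair-g en g j {false} {false} {x})) λ ()
  ... | inj₂ refl = contradiction (trans (sym a) (pair-f en g j {false} {false} {x})) λ ()
  merged : ∀ p q x → X (graph en) (pair en g j p q x) →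
    (p ≡ true × X (contract en g C) (insertAt x j q)) ⊎ (q ≡ true × X (contract en g C) (insertAt x j p))
  merged true q x t = inj₁ (refl , contract-tree en g C t)
  merged false true x t = inj₂ (refl , contract-tree en g C (swap-series en g j S t))
  merged false false x (conn , _) = contradiction (conn v u) (stuck x)

reducible : ∀ {m} k (en : Fin k → Fin m × Fin m) → Connected (graph en) → SeriesParallel (graph en) →
  Reducible (X (graph en))
reducible zero en c sp = base
reducible (suc k) en c sp = reducible-step en c sp (reducible k) (reduction en c sp)

-- Counting embeddings

module Counting where

  open import Data.Nat using (_+_; _*_)
  open import Data.Nat.Combinatorics using (_P_)
  open import Data.Nat.Combinatorics.Base using (_P′_)

  private
    variable
      A B : Set
      n d : ℕ

  -- Finite sums and Cauchy-Schwarz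

  ∑ : List A → (A → ℕ) → ℕ
  ∑ [] f = 0
  ∑ (x ∷ xs) f = f x + ∑ xs f

  ∑-cong : ∀ (xs : List A) {f g} → (∀ x → f x ≡ g x) → ∑ xs f ≡ ∑ xs g
  ∑-cong [] h = refl
  ∑-cong (x ∷ xs) h = cong₂ _+_ (h x) (∑-cong xs h)

  ∑-mono : ∀ (xs : List A) {f g} → (∀ x → f x ≤ g x) → ∑ xs f ≤ ∑ xs g
  ∑-mono [] h = z≤n
  ∑-mono (x ∷ xs) h = +-mono-≤ (h x) (∑-mono xs h)

  ∑-+ : ∀ (xs : List A) f g → ∑ xs (λ x → f x + g x) ≡ ∑ xs f + ∑ xs g
  ∑-+ [] f g = refl
  ∑-+ (x ∷ xs) f g rewrite ∑-+ xs f g = lemma (f x) (g x) (∑ xs f) (∑ xs g)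
    where
    lemma : ∀ a b c d → a + b + (c + d) ≡ a + c + (b + d)
    lemma = solve-∀

  ∑-*ˡ : ∀ (xs : List A) k f → ∑ xs (λ x → k * f x) ≡ k * ∑ xs f
  ∑-*ˡ [] k f = sym (*-zeroʳ k)
  ∑-*ˡ (x ∷ xs) k f rewrite ∑-*ˡ xs k f = sym (*-distribˡ-+ k (f x) (∑ xs f))

  ∑-*ʳ : ∀ (xs : List A) k f → ∑ xs (λ x → f x * k) ≡ ∑ xs f * k
  ∑-*ʳ [] k f = refl
  ∑-*ʳ (x ∷ xs) k f rewrite ∑-*ʳ xs k f = sym (*-distribʳ-+ k (f x) (∑ xs f))

  ∑-const : ∀ (xs : List A) k → ∑ xs (λ _ → k) ≡ length xs * k
  ∑-const [] k = refl
  ∑-const (x ∷ xs) k = cong (k +_) (∑-const xs k)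

  ∑-++ : ∀ (xs ys : List A) f → ∑ (xs ++ ys) f ≡ ∑ xs f + ∑ ys f
  ∑-++ [] ys f = refl
  ∑-++ (x ∷ xs) ys f rewrite ∑-++ xs ys f = sym (+-assoc (f x) _ _)

  ∑-map : ∀ (g : A → B) (xs : List A) f → ∑ (List.map g xs) f ≡ ∑ xs (f ∘ g)
  ∑-map g [] f = refl
  ∑-map g (x ∷ xs) f = cong (_ +_) (∑-map g xs f)

  ∑-swap : ∀ (xs : List A) (ys : List B) (f : A → B → ℕ) → ∑ xs (λ x → ∑ ys (f x)) ≡ ∑ ys (λ y → ∑ xs (λ x → f x y))
  ∑-swap [] ys f = sym (trans (∑-const ys 0) (*-zeroʳ (length ys)))
  ∑-swap (x ∷ xs) ys f rewrite ∑-swap xs ys f = sym (∑-+ ys (f x) _)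

  ∑-product : ∀ {C : Set} (g : A → B → C) (xs : List A) (ys : List B) f →
    ∑ (cartesianProductWith g xs ys) f ≡ ∑ xs (λ x → ∑ ys (λ y → f (g x y)))
  ∑-product g [] ys f = refl
  ∑-product g (x ∷ xs) ys f = trans (∑-++ (List.map (g x) ys) _ f)
    (cong₂ _+_ (∑-map (g x) ys f) (∑-product g xs ys f))

  2ab≤a²+b² : ∀ a b → 2 * (a * b) ≤ a * a + b * b
  2ab≤a²+b² a b = [ ordered a b , (λ q → subst₂ _≤_ (cong (2 *_) (*-comm b a)) (+-comm (b * b) _) (ordered b a q)) ]′ (≤-total a b)
    where
    expand : ∀ a k → 2 * (a * (a + k)) + k * k ≡ a * a + (a + k) * (a + k)
    expand = solve-∀
    ordered : ∀ a b → a ≤ b → 2 * (a * b) ≤ a * a + b * b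
    ordered a b q with m≤n⇒∃[o]m+o≡n q
    ... | k , refl = ≤-trans (m≤m+n _ (k * k)) (≤-reflexive (expand a k))

  -- By induction: each new cross term 2 f(x) f(y) is at most f(x)² + f(y)², and these sum to the
  -- growth of the right side.
  cauchy-schwarz : ∀ (xs : List A) f → ∑ xs f * ∑ xs f ≤ length xs * ∑ xs (λ x → f x * f x)
  cauchy-schwarz [] f = z≤n
  cauchy-schwarz (x ∷ xs) f = begin
    (f x + S) * (f x + S)                        ≡⟨ square (f x) S ⟩
    f x * f x + 2 * (f x * S) + S * S            ≤⟨ +-mono-≤ (+-monoʳ-≤ (f x * f x) cross) (cauchy-schwarz xs f) ⟩
    f x * f x + (l * (f x * f x) + Q) + l * Q    ≡⟨ collect (f x * f x) l Q ⟩
    suc l * (f x * f x + Q)                      ∎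
    where
    open ≤-Reasoning
    S = ∑ xs f
    Q = ∑ xs (λ x → f x * f x)
    l = length xs
    square : ∀ a s → (a + s) * (a + s) ≡ a * a + 2 * (a * s) + s * s
    square = solve-∀
    collect : ∀ a l q → a + (l * a + q) + l * q ≡ (1 + l) * (a + q)
    collect = solve-∀
    cross : 2 * (f x * S) ≤ l * (f x * f x) + Q
    cross = begin
      2 * (f x * S)                            ≡⟨ trans (cong (2 *_) (sym (∑-*ˡ xs (f x) f))) (sym (∑-*ˡ xs 2 _)) ⟩
      ∑ xs (λ y → 2 * (f x * f y))             ≤⟨ ∑-mono xs (λ y → 2ab≤a²+b² (f x) (f y)) ⟩
      ∑ xs (λ y → f x * f x + f y * f y)       ≡⟨ ∑-+ xs _ _ ⟩
      ∑ xs (λ y → f x * f x) + Q               ≡⟨ cong (_+ Q) (∑-const xs _) ⟩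
      l * (f x * f x) + Q                      ∎

  cauchy-schwarz₂ : ∀ (xs : List A) (ys : List B) (f : A → B → ℕ) →
    ∑ xs (λ x → ∑ ys (f x)) * ∑ xs (λ x → ∑ ys (f x)) ≤
    length xs * length ys * ∑ xs (λ x → ∑ ys (λ y → f x y * f x y))
  cauchy-schwarz₂ xs ys f = begin
    ∑ xs (λ x → ∑ ys (f x)) * ∑ xs (λ x → ∑ ys (f x))                         ≤⟨ cauchy-schwarz xs _ ⟩
    length xs * ∑ xs (λ x → ∑ ys (f x) * ∑ ys (f x))                          ≤⟨ *-monoʳ-≤ (length xs) (∑-mono xs λ x → cauchy-schwarz ys (f x)) ⟩
    length xs * ∑ xs (λ x → length ys * ∑ ys (λ y → f x y * f x y))           ≡⟨ cong (length xs *_) (∑-*ˡ xs (length ys) _) ⟩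
    length xs * (length ys * ∑ xs (λ x → ∑ ys (λ y → f x y * f x y)))         ≡⟨ *-assoc (length xs) _ _ ⟨
    length xs * length ys * ∑ xs (λ x → ∑ ys (λ y → f x y * f x y))           ∎
    where open ≤-Reasoning

  𝟙 : ∀ {P : Set} → Dec P → ℕ
  𝟙 (yes _) = 1
  𝟙 (no _) = 0

  𝟙-yes : ∀ {P : Set} (p? : Dec P) → P → 𝟙 p? ≡ 1
  𝟙-yes (yes _) p = refl
  𝟙-yes (no ¬p) p = contradiction p ¬p

  𝟙-no : ∀ {P : Set} (p? : Dec P) → ¬ P → 𝟙 p? ≡ 0
  𝟙-no (yes p) ¬p = contradiction p ¬p
  𝟙-no (no _) ¬p = refl

  𝟙≤1 : ∀ {P : Set} (p? : Dec P) → 𝟙 p? ≤ 1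
  𝟙≤1 (yes _) = ≤-refl
  𝟙≤1 (no _) = z≤n

  𝟙-mono : ∀ {P Q : Set} (p? : Dec P) (q? : Dec Q) → (P → Q) → 𝟙 p? ≤ 𝟙 q?
  𝟙-mono (yes p) q? f = ≤-reflexive (sym (𝟙-yes q? (f p)))
  𝟙-mono (no _) q? f = z≤n

  𝟙-cong : ∀ {P Q : Set} (p? : Dec P) (q? : Dec Q) → (P → Q) → (Q → P) → 𝟙 p? ≡ 𝟙 q?
  𝟙-cong p? q? f g = ≤-antisym (𝟙-mono p? q? f) (𝟙-mono q? p? g)

  length-filter-∑ : ∀ {P : A → Set} (P? : Decidable P) xs → length (filter P? xs) ≡ ∑ xs (λ x → 𝟙 (P? x))
  length-filter-∑ P? [] = refl
  length-filter-∑ P? (x ∷ xs) with P? x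
  ... | yes _ = cong suc (length-filter-∑ P? xs)
  ... | no _ = length-filter-∑ P? xs

  ∑-allFin : ∀ n (f : Fin (suc n) → ℕ) → ∑ (allFin (suc n)) f ≡ f zero + ∑ (allFin n) (f ∘ suc)
  ∑-allFin n f = cong (f zero +_)
    (trans (cong (λ xs → ∑ xs f) (sym (map-tabulate id suc))) (∑-map suc (allFin n) f))

  ∑-allFin-const : ∀ n k → ∑ (allFin n) (λ _ → k) ≡ n * k
  ∑-allFin-const n k = trans (∑-const (allFin n) k) (cong (_* k) (length-tabulate {n = n} id))

  ∑-δ : ∀ {n} (k : Fin n) → ∑ (allFin n) (λ i → 𝟙 (k ≟ i)) ≡ 1
  ∑-δ {suc n} k = trans (∑-allFin n _) (split k)
    where
    split : ∀ k → 𝟙 (k ≟ zero) + ∑ (allFin n) (λ i → 𝟙 (k ≟ suc i)) ≡ 1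
    split zero = cong suc (trans (∑-allFin-const n 0) (*-zeroʳ n))
    split (suc k) = trans (∑-cong (allFin n) λ i → 𝟙-cong (suc k ≟ suc i) (k ≟ i) (λ { refl → refl }) (cong suc)) (∑-δ k)

  -- Sums over the cube

  length-cube : ∀ n → length (cube n) ≡ 2 ^ n
  length-cube zero = refl
  length-cube (suc n) = trans (length-++ (List.map (false ∷_) (cube n))) (cong₂ _+_
    (trans (length-map _ (cube n)) (length-cube n))
    (trans (trans (length-map _ (cube n)) (length-cube n)) (sym (+-identityʳ _))))

  ∑-cube : ∀ n (f : Vec Bool (suc n) → ℕ) →
    ∑ (cube (suc n)) f ≡ ∑ (cube n) (λ c → f (false ∷ c)) + ∑ (cube n) (λ c → f (true ∷ c))
  ∑-cube n f = trans (∑-++ (List.map (false ∷_) (cube n)) _ f) (cong₂ _+_ (∑-map _ (cube n) f) (∑-map _ (cube n) f))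

  -- Flipping coordinate `i` pairs the points of the cube, `f` agrees on each pair, and exactly one
  -- point of the pair has the value `a`.
  ∑-cube-half : ∀ {n} a (i : Fin n) (f : Vec Bool n → ℕ) → (∀ c b → f (c [ i ]≔ b) ≡ f c) →
    ∑ (cube n) f ≡ 2 * ∑ (cube n) (λ c → 𝟙 (lookup c i Bool.≟ a) * f c)
  ∑-cube-half {suc n} a zero f inv = begin
    ∑ (cube (suc n)) f                                      ≡⟨ ∑-cube n f ⟩
    ∑ (cube n) (f ∘ (false ∷_)) + ∑ (cube n) (f ∘ (true ∷_)) ≡⟨ cong₂ _+_ (to-a false) (to-a true) ⟩
    s + s                                                   ≡⟨ cong (s +_) (sym (+-identityʳ s)) ⟩
    2 * s                                                   ≡⟨ cong (2 *_) (sym (halves a)) ⟩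
    2 * (∑ (cube n) (λ c → 𝟙 (false Bool.≟ a) * f (false ∷ c)) + ∑ (cube n) (λ c → 𝟙 (true Bool.≟ a) * f (true ∷ c)))
                                                            ≡⟨ cong (2 *_) (sym (∑-cube n _)) ⟩
    2 * ∑ (cube (suc n)) (λ c → 𝟙 (lookup c zero Bool.≟ a) * f c) ∎
    where
    open ≡-Reasoning
    s = ∑ (cube n) (f ∘ (a ∷_))
    to-a : ∀ b → ∑ (cube n) (f ∘ (b ∷_)) ≡ s
    to-a b = ∑-cong (cube n) λ c → inv (a ∷ c) b
    halves : ∀ a → ∑ (cube n) (λ c → 𝟙 (false Bool.≟ a) * f (false ∷ c)) + ∑ (cube n) (λ c → 𝟙 (true Bool.≟ a) * f (true ∷ c))
      ≡ ∑ (cube n) (f ∘ (a ∷_))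
    halves false = trans (cong₂ _+_ (∑-*ˡ (cube n) 1 _) (∑-*ˡ (cube n) 0 (f ∘ (true ∷_)))) (trans (+-identityʳ _) (*-identityˡ _))
    halves true = trans (cong₂ _+_ (∑-*ˡ (cube n) 0 (f ∘ (false ∷_))) (∑-*ˡ (cube n) 1 _)) (*-identityˡ _)
  ∑-cube-half {suc n} a (suc i) f inv = begin
    ∑ (cube (suc n)) f                                       ≡⟨ ∑-cube n f ⟩
    ∑ (cube n) (f ∘ (false ∷_)) + ∑ (cube n) (f ∘ (true ∷_)) ≡⟨ cong₂ _+_ (ih false) (ih true) ⟩
    2 * h false + 2 * h true                                 ≡⟨ sym (*-distribˡ-+ 2 (h false) (h true)) ⟩
    2 * (h false + h true)                                   ≡⟨ cong (2 *_) (sym (∑-cube n _)) ⟩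
    2 * ∑ (cube (suc n)) (λ c → 𝟙 (lookup c (suc i) Bool.≟ a) * f c) ∎
    where
    open ≡-Reasoning
    h : Bool → ℕ
    h b = ∑ (cube n) (λ c → 𝟙 (lookup c i Bool.≟ a) * f (b ∷ c))
    ih : ∀ b → ∑ (cube n) (f ∘ (b ∷_)) ≡ 2 * h b
    ih b = ∑-cube-half a i (f ∘ (b ∷_)) λ c → inv (b ∷ c)

  occ : Bool → Vec Bool n → ℕ
  occ {n} a c = ∑ (allFin n) λ i → 𝟙 (lookup c i Bool.≟ a)

  occ-∷ : ∀ a b (c : Vec Bool n) → occ a (b ∷ c) ≡ 𝟙 (b Bool.≟ a) + occ a c
  occ-∷ {n} a b c = ∑-allFin n _

  occ-total : ∀ a (c : Vec Bool n) → occ a c + occ (not a) c ≡ n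
  occ-total {n} a c = trans (sym (∑-+ (allFin n) _ _)) (trans (∑-cong (allFin n) λ i → one a (lookup c i))
    (trans (∑-allFin-const n 1) (*-identityʳ n)))
    where
    one : ∀ a b → 𝟙 (b Bool.≟ a) + 𝟙 (b Bool.≟ not a) ≡ 1
    one false false = refl
    one false true = refl
    one true false = refl
    one true true = refl

  -- The second moment ∑ (occ a − occ (not a))² = n 2ⁿ, stated without subtraction.
  ∑-occ : ∀ n a → 4 * ∑ (cube n) (λ c → occ a c * occ (not a) c) + n * 2 ^ n ≡ n * n * 2 ^ n
  ∑-occ zero a = refl
  ∑-occ (suc n) a = begin
    4 * ∑ (cube (suc n)) (λ c → occ a c * occ (not a) c) + suc n * 2 ^ suc n
      ≡⟨ cong (λ x → 4 * x + suc n * 2 ^ suc n) expand ⟩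
    4 * (2 * W + n * N) + suc n * 2 ^ suc n          ≡⟨ arith₁ W n N ⟩
    2 * (4 * W + n * N) + (4 * n + 2) * N            ≡⟨ cong (λ x → 2 * x + (4 * n + 2) * N) (∑-occ n a) ⟩
    2 * (n * n * N) + (4 * n + 2) * N                ≡⟨ arith₂ n N ⟩
    suc n * suc n * 2 ^ suc n                        ∎
    where
    open ≡-Reasoning
    N = 2 ^ n
    W = ∑ (cube n) (λ c → occ a c * occ (not a) c)
    arith₁ : ∀ W n N → 4 * (2 * W + n * N) + (1 + n) * (2 * N) ≡ 2 * (4 * W + n * N) + (4 * n + 2) * N
    arith₁ = solve-∀
    arith₂ : ∀ n N → 2 * (n * n * N) + (4 * n + 2) * N ≡ (1 + n) * (1 + n) * (2 * N)
    arith₂ = solve-∀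
    pointwise : ∀ a (c : Vec Bool n) → occ a (false ∷ c) * occ (not a) (false ∷ c) + occ a (true ∷ c) * occ (not a) (true ∷ c)
      ≡ 2 * (occ a c * occ (not a) c) + (occ a c + occ (not a) c)
    pointwise a c rewrite occ-∷ a false c | occ-∷ (not a) false c | occ-∷ a true c | occ-∷ (not a) true c = go a
      where
      x = occ a c
      y = occ (not a) c
      go : ∀ b → (𝟙 (false Bool.≟ b) + x) * (𝟙 (false Bool.≟ not b) + y) + (𝟙 (true Bool.≟ b) + x) * (𝟙 (true Bool.≟ not b) + y)
        ≡ 2 * (x * y) + (x + y)
      go false = lemma x y where
        lemma : ∀ x y → (1 + x) * (0 + y) + (0 + x) * (1 + y) ≡ 2 * (x * y) + (x + y)
        lemma = solve-∀
      go true = lemma x y where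
        lemma : ∀ x y → (0 + x) * (1 + y) + (1 + x) * (0 + y) ≡ 2 * (x * y) + (x + y)
        lemma = solve-∀
    expand : ∑ (cube (suc n)) (λ c → occ a c * occ (not a) c) ≡ 2 * W + n * N
    expand = begin
      ∑ (cube (suc n)) (λ c → occ a c * occ (not a) c)      ≡⟨ ∑-cube n _ ⟩
      _                                                     ≡⟨ ∑-+ (cube n) _ _ ⟨
      _                                                     ≡⟨ ∑-cong (cube n) (pointwise a) ⟩
      _                                                     ≡⟨ ∑-+ (cube n) _ _ ⟩
      ∑ (cube n) (λ c → 2 * (occ a c * occ (not a) c)) + ∑ (cube n) (λ c → occ a c + occ (not a) c)
        ≡⟨ cong₂ _+_ (∑-*ˡ (cube n) 2 _) (trans (∑-cong (cube n) (occ-total a))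
             (trans (∑-const (cube n) n) (trans (cong (_* n) (length-cube n)) (*-comm N n)))) ⟩
      2 * W + n * N ∎

  -- Placements and their number

  tuples : ∀ n d → List (Vec (Fin n) d)
  tuples n zero = [] ∷ []
  tuples n (suc d) = cartesianProductWith _∷_ (allFin n) (tuples n d)

  length-tuples : ∀ n d → length (tuples n d) ≡ n ^ d
  length-tuples n zero = refl
  length-tuples n (suc d) = begin
    length (tuples n (suc d))                              ≡⟨ ∑-1 (tuples n (suc d)) ⟨
    ∑ (tuples n (suc d)) (λ _ → 1)                         ≡⟨ ∑-product _∷_ (allFin n) (tuples n d) _ ⟩
    ∑ (allFin n) (λ _ → ∑ (tuples n d) λ _ → 1)            ≡⟨ ∑-allFin-const n _ ⟩
    n * ∑ (tuples n d) (λ _ → 1)                           ≡⟨ cong (n *_) (trans (∑-1 (tuples n d)) (length-tuples n d)) ⟩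
    n ^ suc d                                              ∎
    where
    open ≡-Reasoning
    ∑-1 : ∀ {A : Set} (xs : List A) → ∑ xs (λ _ → 1) ≡ length xs
    ∑-1 xs = trans (∑-const xs 1) (*-identityʳ _)

  ∑-tuples : ∀ n d (f : Vec (Fin n) (suc d) → ℕ) →
    ∑ (tuples n (suc d)) f ≡ ∑ (allFin n) (λ i → ∑ (tuples n d) (λ σ → f (i ∷ σ)))
  ∑-tuples n d f = ∑-product _∷_ (allFin n) (tuples n d) f

  ∑-tuples-insertAt : ∀ n {d} (g : Fin (suc d)) (f : Vec (Fin n) (suc d) → ℕ) →
    ∑ (tuples n (suc d)) f ≡ ∑ (allFin n) (λ i → ∑ (tuples n d) (λ σ → f (insertAt σ g i)))
  ∑-tuples-insertAt n {d} zero f = ∑-tuples n d f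
  ∑-tuples-insertAt n {suc d} (suc g) f = begin
    ∑ (tuples n (suc (suc d))) f                                                          ≡⟨ ∑-tuples n (suc d) f ⟩
    ∑ (allFin n) (λ j → ∑ (tuples n (suc d)) (λ σ → f (j ∷ σ)))                           ≡⟨ ∑-cong (allFin n) (λ j → ∑-tuples-insertAt n g (f ∘ (j ∷_))) ⟩
    ∑ (allFin n) (λ j → ∑ (allFin n) (λ i → ∑ (tuples n d) (λ σ → f (j ∷ insertAt σ g i)))) ≡⟨ ∑-swap (allFin n) (allFin n) _ ⟩
    ∑ (allFin n) (λ i → ∑ (allFin n) (λ j → ∑ (tuples n d) (λ σ → f (j ∷ insertAt σ g i)))) ≡⟨ ∑-cong (allFin n) (λ i → sym (∑-tuples n d _)) ⟩
    ∑ (allFin n) (λ i → ∑ (tuples n (suc d)) (λ σ → f (insertAt σ (suc g) i)))            ∎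
    where open ≡-Reasoning

  Inj : Vec (Fin n) d → Set
  Inj σ = ∀ i j → lookup σ i ≡ lookup σ j → i ≡ j

  inj? : ∀ (σ : Vec (Fin n) d) → Dec (Inj σ)
  inj? σ = all? λ i → all? λ j → (lookup σ i ≟ lookup σ j) →-dec (i ≟ j)

  inj-insertAt : ∀ {σ : Vec (Fin n) d} g {i} → Inj σ → (∀ j → lookup σ j ≢ i) → Inj (insertAt σ g i)
  inj-insertAt {σ = σ} g {i} inj new j k p with punchIn-view g j | punchIn-view g k
  ... | inj₁ refl | inj₁ refl = refl
  ... | inj₁ refl | inj₂ (k′ , refl) = contradiction
        (trans (sym (insertAt-punchIn σ g i k′)) (trans (sym p) (insertAt-lookup σ g i))) (new k′)
  ... | inj₂ (j′ , refl) | inj₁ refl = contradiction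
        (trans (sym (insertAt-punchIn σ g i j′)) (trans p (insertAt-lookup σ g i))) (new j′)
  ... | inj₂ (j′ , refl) | inj₂ (k′ , refl) = cong (punchIn g) (inj j′ k′
        (trans (sym (insertAt-punchIn σ g i j′)) (trans p (insertAt-punchIn σ g i k′))))

  inj-insertAt⁻ : ∀ {σ : Vec (Fin n) d} g {i} → Inj (insertAt σ g i) → Inj σ × (∀ j → lookup σ j ≢ i)
  inj-insertAt⁻ {σ = σ} g {i} inj =
    (λ j k p → punchIn-injective g j k (inj _ _
      (trans (insertAt-punchIn σ g i j) (trans p (sym (insertAt-punchIn σ g i k)))))) ,
    (λ j p → punchInᵢ≢i g j (inj _ _ (trans (insertAt-punchIn σ g i j) (trans p (sym (insertAt-lookup σ g i))))))

  -- Writes at distinct coordinates commute, so the write at `i` may come first.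
  emb-insertAt : ∀ {σ : Vec (Fin n) d} g {i} c x a → (∀ j → lookup σ j ≢ i) →
    applyEmb (insertAt σ g i , c) (insertAt x g a) ≡ applyEmb (i ∷ σ , c) (a ∷ x)
  emb-insertAt zero c x a new = refl
  emb-insertAt {σ = k ∷ σ} (suc g) {i} c (b ∷ x) a new = trans (emb-insertAt g (c [ k ]≔ b) x a (new ∘ suc))
    (cong (λ z → applyEmb (σ , z) x) ([]≔-commutes c k i (new zero)))

  -- The embedding overwrites this coordinate anyway. Hence being good does not depend on the values
  -- of the base point on the image of `σ`.
  emb-overwrite : ∀ {σ : Vec (Fin n) d} c x j b → Inj σ → applyEmb (σ , c [ lookup σ j ]≔ b) x ≡ applyEmb (σ , c) x
  emb-overwrite {σ = i ∷ σ} c (y ∷ x) zero b inj = cong (λ z → applyEmb (σ , z) x) ([]≔-idempotent c i)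
  emb-overwrite {σ = i ∷ σ} c (y ∷ x) (suc j) b inj = trans
    (cong (λ z → applyEmb (σ , z) x) ([]≔-commutes c (lookup σ j) i (proj₂ (inj-insertAt⁻ zero inj) j)))
    (emb-overwrite {σ = σ} (c [ i ]≔ y) x j b (proj₁ (inj-insertAt⁻ {σ = σ} zero inj)))

  all-vec? : ∀ {d} {P : Vec Bool d → Set} → Decidable P → Dec (∀ x → P x)
  all-vec? {zero} P? = map′ (λ { p [] → p }) (λ f → f []) (P? [])
  all-vec? {suc d} P? = map′ (λ { (p , q) (false ∷ x) → p x ; (p , q) (true ∷ x) → q x })
    (λ f → f ∘ (false ∷_) , f ∘ (true ∷_)) (all-vec? (P? ∘ (false ∷_)) ×-dec all-vec? (P? ∘ (true ∷_)))

  -- Here c may be arbitrary on the image of σ, where applyEmb overwrites it, so every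
  -- oriented embedding is counted 2ᵈ times.
  Good : (Vec Bool d → Set) → (Vec Bool n → Bool) → Vec (Fin n) d → Vec Bool n → Set
  Good Y S σ c = Inj σ × (∀ x → Y x → S (applyEmb (σ , c) x) ≡ true)

  abstract
    good? : ∀ {Y : Vec Bool d → Set} → Decidable Y → (S : Vec Bool n → Bool) → ∀ σ c → Dec (Good Y S σ c)
    good? Y? S σ c = inj? σ ×-dec all-vec? λ x → Y? x →-dec (S (applyEmb (σ , c) x) Bool.≟ true)

  hom : ∀ {Y : Vec Bool d → Set} → Decidable Y → (Vec Bool n → Bool) → ℕ
  hom {d} {n} Y? S = ∑ (tuples n d) λ σ → ∑ (cube n) λ c → 𝟙 (good? Y? S σ c)

  -- Tuples with repeated entries are included, which makes it an exact product; `hom` counts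
  -- injective tuples only.
  total : ℕ → ℕ → ℕ
  total n d = n ^ d * 2 ^ n

  ∑∑-const : ∀ n d k → ∑ (tuples n d) (λ _ → ∑ (cube n) λ _ → k) ≡ total n d * k
  ∑∑-const n d k = begin
    ∑ (tuples n d) (λ _ → ∑ (cube n) λ _ → k) ≡⟨ ∑-const (tuples n d) _ ⟩
    length (tuples n d) * ∑ (cube n) (λ _ → k) ≡⟨ cong₂ _*_ (length-tuples n d) (∑-const (cube n) k) ⟩
    n ^ d * (length (cube n) * k)             ≡⟨ cong (λ z → n ^ d * (z * k)) (length-cube n) ⟩
    n ^ d * (2 ^ n * k)                       ≡⟨ *-assoc (n ^ d) (2 ^ n) k ⟨
    total n d * k                             ∎
    where open ≡-Reasoning

  good-move : ∀ {Y Z : Vec Bool (suc d) → Set} g {S : Vec Bool n → Bool} {σ i c} →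
    (∀ a x → Y (a ∷ x) → Z (insertAt x g a)) → Good Z S (insertAt σ g i) c → Good Y S (i ∷ σ) c
  good-move {Y = Y} {Z} g {S} {σ} {i} {c} f (inj , h) = inj-insertAt zero inj′ new ,
    λ { (a ∷ x) y → subst (λ z → S z ≡ true) (emb-insertAt g c x a new) (h _ (f a x y)) }
    where
    inj′ = proj₁ (inj-insertAt⁻ {σ = σ} g {i} inj)
    new = proj₂ (inj-insertAt⁻ {σ = σ} g {i} inj)

  good-move⁻ : ∀ {Y Z : Vec Bool (suc d) → Set} g {S : Vec Bool n → Bool} {σ i c} →
    (∀ a x → Z (insertAt x g a) → Y (a ∷ x)) → Good Y S (i ∷ σ) c → Good Z S (insertAt σ g i) c
  good-move⁻ {Y = Y} {Z} g {S} {σ} {i} {c} f (inj , h) = inj-insertAt g inj′ new ,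
    λ x z → subst (λ x → S (applyEmb (insertAt σ g i , c) x) ≡ true) (insertAt-removeAt x g)
      (subst (λ z → S z ≡ true) (sym (emb-insertAt g c (removeAt x g) (lookup x g) new))
        (h _ (f _ _ (subst Z (sym (insertAt-removeAt x g)) z))))
    where
    inj′ = proj₁ (inj-insertAt⁻ {σ = σ} zero {i} inj)
    new = proj₂ (inj-insertAt⁻ {σ = σ} zero {i} inj)

  hom-move : ∀ {Y Z : Vec Bool (suc d) → Set} (Y? : Decidable Y) (Z? : Decidable Z) g (S : Vec Bool n → Bool) →
    (∀ a x → Y (a ∷ x) → Z (insertAt x g a)) → (∀ a x → Z (insertAt x g a) → Y (a ∷ x)) →
    hom Z? S ≡ hom Y? S
  hom-move {d} {n} Y? Z? g S f f⁻ = begin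
    hom Z? S ≡⟨ ∑-tuples-insertAt n g _ ⟩
    _        ≡⟨ ∑-cong (allFin n) (λ i → ∑-cong (tuples n d) λ σ → ∑-cong (cube n) λ c →
                  𝟙-cong (good? Z? S (insertAt σ g i) c) (good? Y? S (i ∷ σ) c) (good-move g {S} {σ} {i} {c} f) (good-move⁻ g {S} {σ} {i} {c} f⁻)) ⟩
    _        ≡⟨ ∑-tuples n d _ ⟨
    hom Y? S ∎
    where open ≡-Reasoning

  -- With δ = |S| / 2ⁿ and h = hom / total this says δʳ ≤ C h + K / n.
  Bounded : ∀ {Y : Vec Bool d → Set} → Decidable Y → Set
  Bounded {d} Y? = ∃ λ C → ∃ λ K → ∃ λ r → NonZero r × (∀ n → NonZero n → (S : Vec Bool n → Bool) →
    card S ^ r * (n * total n d) ≤ (C * (n * hom Y? S) + K * total n d) * (2 ^ n) ^ r)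

  bounded-hom : ∀ {Y Z : Vec Bool d → Set} {Y? : Decidable Y} {Z? : Decidable Z} →
    (∀ n (S : Vec Bool n → Bool) → hom Y? S ≡ hom Z? S) → Bounded Y? → Bounded Z?
  bounded-hom {d} eq (C , K , r , nz , bd) = C , K , r , nz , λ n n≢0 S →
    subst (λ h → card S ^ r * (n * total n d) ≤ (C * (n * h) + K * total n d) * (2 ^ n) ^ r) (eq n S) (bd n n≢0 S)

  -- Adding a constant coordinate

  Const : Bool → (Vec Bool d → Set) → Vec Bool (suc d) → Set
  Const a Y (b ∷ x) = b ≡ a × Y x

  const? : ∀ a {Y : Vec Bool d → Set} → Decidable Y → Decidable (Const a Y)
  const? a Y? (b ∷ x) = (b Bool.≟ a) ×-dec Y? x

  module _ (a : Bool) {Y : Vec Bool d → Set} (Y? : Decidable Y) {n : ℕ} (S : Vec Bool n → Bool) where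

    private
      g : Vec (Fin n) d → Vec Bool n → ℕ
      g σ c = 𝟙 (good? Y? S σ c)
      Q : Vec (Fin n) d → Vec Bool n → ℕ
      Q σ c = ∑ (allFin n) λ i → 𝟙 (good? (const? a Y?) S (i ∷ σ) c)
      N = 2 ^ n

    -- The base point already has the value `a` at `i`, so writing `a` there changes nothing.
    const-good : ∀ {σ c i} → Good Y S σ c → lookup c i ≡ a → (∀ j → lookup σ j ≢ i) → Good (Const a Y) S (i ∷ σ) c
    const-good {σ} {c} {i} (inj , h) refl new = inj-insertAt zero inj new , λ { (b ∷ x) (refl , y) →
      subst (λ z → S (applyEmb (σ , z) x) ≡ true) (sym ([]≔-lookup c i)) (h x y) }

    ∑-occurrences : ∀ (σ : Vec (Fin n) d) → ∑ (allFin n) (λ i → ∑ (allFin d) λ j → 𝟙 (lookup σ j ≟ i)) ≡ d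
    ∑-occurrences σ = begin
      _ ≡⟨ ∑-swap (allFin n) (allFin d) _ ⟩
      _ ≡⟨ ∑-cong (allFin d) (λ j → ∑-δ (lookup σ j)) ⟩
      _ ≡⟨ ∑-allFin-const d 1 ⟩
      d * 1 ≡⟨ *-identityʳ d ⟩
      d ∎
      where open ≡-Reasoning

    ∑-member : ∀ {m} {P : Fin m → Set} (P? : Decidable P) j → P j → 1 ≤ ∑ (allFin m) (λ j → 𝟙 (P? j))
    ∑-member {suc m} P? zero p = ≤-trans (≤-reflexive (sym (𝟙-yes (P? zero) p))) (≤-trans (m≤m+n _ _) (≤-reflexive (sym (∑-allFin m _))))
    ∑-member {suc m} P? (suc j) p = ≤-trans (∑-member (P? ∘ suc) j p) (≤-trans (m≤n+m _ _) (≤-reflexive (sym (∑-allFin m _))))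

    -- Every coordinate with value `a` extends the placement unless it lies in the image of `σ`,
    -- which accounts for at most `d` of them.
    occ≤Q : ∀ {σ c} → Good Y S σ c → occ a c ≤ Q σ c + d
    occ≤Q {σ} {c} good = begin
      occ a c ≤⟨ ∑-mono (allFin n) pointwise ⟩
      ∑ (allFin n) (λ i → 𝟙 (good? (const? a Y?) S (i ∷ σ) c) + ∑ (allFin d) λ j → 𝟙 (lookup σ j ≟ i)) ≡⟨ ∑-+ (allFin n) _ _ ⟩
      Q σ c + _ ≡⟨ cong (Q σ c +_) (∑-occurrences σ) ⟩
      Q σ c + d ∎
      where
      open ≤-Reasoning
      pointwise : ∀ i → 𝟙 (lookup c i Bool.≟ a) ≤ 𝟙 (good? (const? a Y?) S (i ∷ σ) c) + ∑ (allFin d) λ j → 𝟙 (lookup σ j ≟ i)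
      pointwise i with lookup c i Bool.≟ a | any? (λ j → lookup σ j ≟ i)
      ... | no _ | _ = z≤n
      ... | yes e | no new = ≤-trans (≤-reflexive (sym (𝟙-yes (good? (const? a Y?) S (i ∷ σ) c)
                               (const-good good e λ j p → new (j , p))))) (m≤m+n _ _)
      ... | yes e | yes (j , p) = ≤-trans (∑-member (λ j → lookup σ j ≟ i) j p) (m≤n+m _ _)

    -- With x = `occ a c` and y = n - x this reads n² g ≤ (x - y)² + 4n(Q + d). For a good placement
    -- n² = (x - y)² + 4xy, where 4xy ≤ 4nx and x ≤ Q + d; otherwise the left side is 0.
    const-pointwise : ∀ σ c → n * n * g σ c + 4 * (occ a c * occ (not a) c) ≤ n * n + 4 * (n * (Q σ c + d))
    const-pointwise σ c = subst (λ m → m * m * g σ c + 4 * (x * y) ≤ m * m + 4 * (m * (Q σ c + d))) (occ-total a c) main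
      where
      open ≤-Reasoning
      x = occ a c
      y = occ (not a) c
      expand : ∀ x y → 4 * (x * y) + (4 * (x * x)) ≡ 4 * ((x + y) * x)
      expand = solve-∀
      square : ∀ x y → 2 * (x * y) + (x * x + y * y) ≡ (x + y) * (x + y)
      square = solve-∀
      split : ∀ x y → 4 * (x * y) ≡ 2 * (x * y) + 2 * (x * y)
      split = solve-∀
      main : (x + y) * (x + y) * g σ c + 4 * (x * y) ≤ (x + y) * (x + y) + 4 * ((x + y) * (Q σ c + d))
      main with good? Y? S σ c
      ... | yes good = begin
        (x + y) * (x + y) * 1 + 4 * (x * y) ≤⟨ +-mono-≤ (≤-reflexive (*-identityʳ ((x + y) * (x + y)))) (m≤m+n (4 * (x * y)) (4 * (x * x))) ⟩
        (x + y) * (x + y) + (4 * (x * y) + 4 * (x * x)) ≡⟨ cong ((x + y) * (x + y) +_) (expand x y) ⟩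
        (x + y) * (x + y) + 4 * ((x + y) * x) ≤⟨ +-monoʳ-≤ ((x + y) * (x + y)) (*-monoʳ-≤ 4 (*-monoʳ-≤ (x + y) (occ≤Q good))) ⟩
        (x + y) * (x + y) + 4 * ((x + y) * (Q σ c + d)) ∎
      ... | no _ = begin
        (x + y) * (x + y) * 0 + 4 * (x * y) ≡⟨ cong (_+ 4 * (x * y)) (*-zeroʳ ((x + y) * (x + y))) ⟩
        4 * (x * y) ≡⟨ split x y ⟩
        2 * (x * y) + 2 * (x * y) ≤⟨ +-monoʳ-≤ (2 * (x * y)) (2ab≤a²+b² x y) ⟩
        2 * (x * y) + (x * x + y * y) ≡⟨ square x y ⟩
        (x + y) * (x + y) ≤⟨ m≤m+n _ _ ⟩
        (x + y) * (x + y) + 4 * ((x + y) * (Q σ c + d)) ∎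

    -- Summing the pointwise bound over the cube, the squared deviations contribute only n 2ⁿ, a
    -- factor n below the main term. This second moment takes the place of a tail estimate.
    const-row : .{{_ : NonZero n}} → ∀ σ → n * ∑ (cube n) (g σ) ≤ (1 + 4 * d) * N + 4 * ∑ (cube n) (Q σ)
    const-row σ = *-cancelˡ-≤ n (+-cancelʳ-≤ (n * n * N) _ _ (begin
      n * (n * G) + n * n * N                       ≡⟨ cong₂ _+_ (*-assoc n n G) (∑-occ n a) ⟨
      n * n * G + (4 * W + n * N)                   ≡⟨ +-assoc (n * n * G) (4 * W) (n * N) ⟨
      n * n * G + 4 * W + n * N                     ≤⟨ +-monoˡ-≤ (n * N) summed ⟩
      N * (n * n) + 4 * (n * (R + N * d)) + n * N   ≡⟨ arith n N R d ⟩
      n * ((1 + 4 * d) * N + 4 * R) + n * n * N     ∎))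
      where
      open ≤-Reasoning
      G = ∑ (cube n) (g σ)
      W = ∑ (cube n) (λ c → occ a c * occ (not a) c)
      R = ∑ (cube n) (Q σ)
      arith : ∀ n N R d → N * (n * n) + 4 * (n * (R + N * d)) + n * N ≡ n * ((1 + 4 * d) * N + 4 * R) + n * n * N
      arith = solve-∀
      summed : n * n * G + 4 * W ≤ N * (n * n) + 4 * (n * (R + N * d))
      summed = begin
        n * n * G + 4 * W ≡⟨ cong₂ _+_ (∑-*ˡ (cube n) (n * n) _) (∑-*ˡ (cube n) 4 _) ⟨
        _ ≡⟨ ∑-+ (cube n) _ _ ⟨
        ∑ (cube n) (λ c → n * n * g σ c + 4 * (occ a c * occ (not a) c)) ≤⟨ ∑-mono (cube n) (const-pointwise σ) ⟩
        ∑ (cube n) (λ c → n * n + 4 * (n * (Q σ c + d))) ≡⟨ ∑-+ (cube n) _ _ ⟩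
        ∑ (cube n) (λ c → n * n) + ∑ (cube n) (λ c → 4 * (n * (Q σ c + d))) ≡⟨ cong₂ _+_
            (trans (∑-const (cube n) (n * n)) (cong (_* (n * n)) (length-cube n)))
            (trans (∑-*ˡ (cube n) 4 _) (cong (4 *_) (trans (∑-*ˡ (cube n) n _) (cong (n *_)
              (trans (∑-+ (cube n) _ _) (cong (R +_) (trans (∑-const (cube n) d) (cong (_* d) (length-cube n))))))))) ⟩
        N * (n * n) + 4 * (n * (R + N * d)) ∎

    hom-const : .{{_ : NonZero n}} → n * hom Y? S ≤ (1 + 4 * d) * total n d + 4 * hom (const? a Y?) S
    hom-const = begin
      n * hom Y? S ≡⟨ ∑-*ˡ (tuples n d) n _ ⟨
      ∑ (tuples n d) (λ σ → n * ∑ (cube n) (g σ)) ≤⟨ ∑-mono (tuples n d) const-row ⟩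
      ∑ (tuples n d) (λ σ → (1 + 4 * d) * N + 4 * ∑ (cube n) (Q σ)) ≡⟨ ∑-+ (tuples n d) _ _ ⟩
      _ ≡⟨ cong₂ _+_ first second ⟩
      (1 + 4 * d) * total n d + 4 * hom (const? a Y?) S ∎
      where
      open ≤-Reasoning
      arith : ∀ D N k → D * (k * N) ≡ k * (D * N)
      arith = solve-∀
      first : ∑ (tuples n d) (λ σ → (1 + 4 * d) * N) ≡ (1 + 4 * d) * total n d
      first = trans (∑-const (tuples n d) _) (trans (cong (_* ((1 + 4 * d) * N)) (length-tuples n d)) (arith (n ^ d) N (1 + 4 * d)))
      second : ∑ (tuples n d) (λ σ → 4 * ∑ (cube n) (Q σ)) ≡ 4 * hom (const? a Y?) S
      second = trans (∑-*ˡ (tuples n d) 4 _) (cong (4 *_) (trans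
        (∑-cong (tuples n d) λ σ → ∑-swap (cube n) (allFin n) _)
        (trans (∑-swap (tuples n d) (allFin n) _) (sym (∑-tuples n d _)))))

  bounded-const : ∀ a {Y : Vec Bool d → Set} {Y? : Decidable Y} → Bounded Y? → Bounded (const? a Y?)
  bounded-const {d} a {Y? = Y?} (C , K , r , nz , bd) = 4 * C , C * (1 + 4 * d) + K , r , nz , λ n n≢0 S →
    let instance _ = n≢0
        s = card S ^ r ; D = total n d ; R = (2 ^ n) ^ r ; H = hom Y? S ; H′ = hom (const? a Y?) S
    in subst (λ D′ → s * (n * D′) ≤ (4 * C * (n * H′) + (C * (1 + 4 * d) + K) * D′) * R) (sym (*-assoc n (n ^ d) (2 ^ n))) (begin
      s * (n * (n * D))                                            ≡⟨ arith₁ s n D ⟩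
      n * (s * (n * D))                                            ≤⟨ *-monoʳ-≤ n (bd n n≢0 S) ⟩
      n * ((C * (n * H) + K * D) * R)                              ≤⟨ *-monoʳ-≤ n (*-monoˡ-≤ R (+-monoˡ-≤ (K * D) (*-monoʳ-≤ C (hom-const a Y? S)))) ⟩
      n * ((C * ((1 + 4 * d) * D + 4 * H′) + K * D) * R)           ≡⟨ arith₂ n C K D d H′ R ⟩
      (4 * C * (n * H′) + (C * (1 + 4 * d) + K) * (n * D)) * R     ∎)
    where
    open ≤-Reasoning
    arith₁ : ∀ s n D → s * (n * (n * D)) ≡ n * (s * (n * D))
    arith₁ = solve-∀
    arith₂ : ∀ n C K D d H R → n * ((C * ((1 + 4 * d) * D + 4 * H) + K * D) * R) ≡ (4 * C * (n * H) + (C * (1 + 4 * d) + K) * (n * D)) * R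
    arith₂ = solve-∀

  -- Doubling a coordinate

  Merge : Bool → (Vec Bool (suc d) → Set) → Vec Bool (suc (suc d)) → Set
  Merge a Y (p ∷ q ∷ x) = (p ≡ a × Y (q ∷ x)) ⊎ (q ≡ a × Y (p ∷ x))

  merge? : ∀ a {Y : Vec Bool (suc d) → Set} → Decidable Y → Decidable (Merge a Y)
  merge? a Y? (p ∷ q ∷ x) = ((p Bool.≟ a) ×-dec Y? (q ∷ x)) ⊎-dec ((q Bool.≟ a) ×-dec Y? (p ∷ x))

  module _ (a : Bool) {Y : Vec Bool (suc d) → Set} (Y? : Decidable Y) {n : ℕ} (S : Vec Bool n → Bool) where

    private
      g : Vec (Fin n) (suc d) → Vec Bool n → ℕ
      g σ c = 𝟙 (good? Y? S σ c)
      g⁺ : Vec (Fin n) (suc (suc d)) → Vec Bool n → ℕ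
      g⁺ σ c = 𝟙 (good? (merge? a Y?) S σ c)

    anchored : Fin n → Vec (Fin n) d → Vec Bool n → ℕ
    anchored i σ c = 𝟙 (lookup c i Bool.≟ a) * g (i ∷ σ) c

    anchoredSum : ℕ
    anchoredSum = ∑ (tuples n d) λ σ → ∑ (cube n) λ c → ∑ (allFin n) λ i → anchored i σ c

    -- If p = a, the write at `i` is void and what remains is the placement at `j`. The case q = a
    -- is symmetric.
    merge-good : ∀ {i j σ c} → i ≢ j → lookup c i ≡ a → lookup c j ≡ a →
      Good Y S (i ∷ σ) c → Good Y S (j ∷ σ) c → Good (Merge a Y) S (i ∷ j ∷ σ) c
    merge-good {i} {j} {σ} {c} i≢j ci cj (inj-i , hi) (inj-j , hj) =
      inj-insertAt zero inj-j new , λ where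
        (p ∷ q ∷ x) (inj₁ (refl , y)) → subst (λ z → S (applyEmb (σ , z [ j ]≔ q) x) ≡ true) (sym (restore ci)) (hj (q ∷ x) y)
        (p ∷ q ∷ x) (inj₂ (refl , y)) → subst (λ z → S (applyEmb (σ , z) x) ≡ true)
          (trans (cong (_[ i ]≔ p) (sym (restore cj))) ([]≔-commutes c j i (≢-sym i≢j))) (hi (p ∷ x) y)
      where
      restore : ∀ {k} → lookup c k ≡ a → c [ k ]≔ a ≡ c
      restore {k} refl = []≔-lookup c k
      new : ∀ k → lookup (j ∷ σ) k ≢ i
      new zero = ≢-sym i≢j
      new (suc k) = proj₂ (inj-insertAt⁻ {σ = σ} zero inj-i) k

    hom-anchored : hom Y? S ≡ 2 * anchoredSum
    hom-anchored = begin
      hom Y? S ≡⟨ ∑-tuples n d _ ⟩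
      ∑ (allFin n) (λ i → ∑ (tuples n d) λ σ → ∑ (cube n) λ c → g (i ∷ σ) c) ≡⟨ ∑-swap (allFin n) (tuples n d) _ ⟩
      ∑ (tuples n d) (λ σ → ∑ (allFin n) λ i → ∑ (cube n) λ c → g (i ∷ σ) c) ≡⟨ ∑-cong (tuples n d) (λ σ →
        trans (∑-cong (allFin n) λ i → ∑-cube-half a i (g (i ∷ σ)) (indep σ i))
        (trans (∑-*ˡ (allFin n) 2 _) (cong (2 *_) (∑-swap (allFin n) (cube n) _)))) ⟩
      ∑ (tuples n d) (λ σ → 2 * ∑ (cube n) λ c → ∑ (allFin n) λ i → anchored i σ c) ≡⟨ ∑-*ˡ (tuples n d) 2 _ ⟩
      2 * anchoredSum ∎
      where
      open ≡-Reasoning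
      indep : ∀ σ i c b → g (i ∷ σ) (c [ i ]≔ b) ≡ g (i ∷ σ) c
      indep σ i c b = 𝟙-cong (good? Y? S (i ∷ σ) (c [ i ]≔ b)) (good? Y? S (i ∷ σ) c)
        (λ (inj , h) → inj , λ x y → subst (λ z → S z ≡ true) (emb-overwrite {σ = i ∷ σ} c x zero b inj) (h x y))
        (λ (inj , h) → inj , λ x y → subst (λ z → S z ≡ true) (sym (emb-overwrite {σ = i ∷ σ} c x zero b inj)) (h x y))

    -- A pair of distinct good indices combines. The diagonal yields no injective tuple and is paid
    -- for by the last term, which summed over `j` leaves a single `anchored i σ c`.
    anchored-pair : ∀ σ c i j → anchored i σ c * anchored j σ c ≤ g⁺ (i ∷ j ∷ σ) c + 𝟙 (i ≟ j) * anchored i σ c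
    anchored-pair σ c i j with i ≟ j
    ... | yes refl = ≤-trans (≤-trans (*-monoʳ-≤ (anchored i σ c) (*-mono-≤ (𝟙≤1 (lookup c i Bool.≟ a)) (𝟙≤1 (good? Y? S (i ∷ σ) c))))
            (≤-reflexive (trans (*-identityʳ (anchored i σ c)) (sym (*-identityˡ (anchored i σ c))))))
            (m≤n+m (1 * anchored i σ c) (g⁺ (i ∷ i ∷ σ) c))
    ... | no i≢j with lookup c i Bool.≟ a | lookup c j Bool.≟ a | good? Y? S (i ∷ σ) c | good? Y? S (j ∷ σ) c
    ...   | no _ | _ | _ | _ = z≤n
    ...   | yes _ | _ | no _ | _ = z≤n
    ...   | yes _ | no _ | yes _ | _ = z≤n
    ...   | yes _ | yes _ | yes _ | no _ = z≤n
    ...   | yes ci | yes cj | yes hi | yes hj = ≤-trans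
              (≤-reflexive (sym (𝟙-yes (good? (merge? a Y?) S (i ∷ j ∷ σ) c) (merge-good i≢j ci cj hi hj)))) (m≤m+n _ _)

    anchored-square : ∀ σ c → ∑ (allFin n) (λ i → anchored i σ c) * ∑ (allFin n) (λ i → anchored i σ c) ≤
      ∑ (allFin n) (λ i → ∑ (allFin n) λ j → g⁺ (i ∷ j ∷ σ) c) + ∑ (allFin n) (λ i → anchored i σ c)
    anchored-square σ c = begin
      s * s ≡⟨ ∑-*ʳ (allFin n) s _ ⟨
      ∑ (allFin n) (λ i → anchored i σ c * s) ≡⟨ ∑-cong (allFin n) (λ i → ∑-*ˡ (allFin n) (anchored i σ c) _) ⟨
      ∑ (allFin n) (λ i → ∑ (allFin n) λ j → anchored i σ c * anchored j σ c) ≤⟨ ∑-mono (allFin n) (λ i → row i) ⟩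
      ∑ (allFin n) (λ i → ∑ (allFin n) (λ j → g⁺ (i ∷ j ∷ σ) c) + anchored i σ c) ≡⟨ ∑-+ (allFin n) _ _ ⟩
      ∑ (allFin n) (λ i → ∑ (allFin n) λ j → g⁺ (i ∷ j ∷ σ) c) + s ∎
      where
      open ≤-Reasoning
      s = ∑ (allFin n) (λ i → anchored i σ c)
      row : ∀ i → ∑ (allFin n) (λ j → anchored i σ c * anchored j σ c) ≤ ∑ (allFin n) (λ j → g⁺ (i ∷ j ∷ σ) c) + anchored i σ c
      row i = begin
        _ ≤⟨ ∑-mono (allFin n) (anchored-pair σ c i) ⟩
        _ ≡⟨ ∑-+ (allFin n) _ _ ⟩
        _ ≡⟨ cong (∑ (allFin n) (λ j → g⁺ (i ∷ j ∷ σ) c) +_) (trans (∑-*ʳ (allFin n) (anchored i σ c) _) (trans (cong (_* anchored i σ c) (∑-δ i)) (*-identityˡ _))) ⟩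
        ∑ (allFin n) (λ j → g⁺ (i ∷ j ∷ σ) c) + anchored i σ c ∎

    -- Cauchy-Schwarz over the `total n d` pairs `(σ , c)`: the square of the inner sum counts pairs
    -- of placements that share `σ` and `c`.
    hom-merge : anchoredSum * anchoredSum ≤ total n d * (hom (merge? a Y?) S + anchoredSum)
    hom-merge = begin
      anchoredSum * anchoredSum ≤⟨ cauchy-schwarz₂ (tuples n d) (cube n) _ ⟩
      length (tuples n d) * length (cube n) * ∑ (tuples n d) (λ σ → ∑ (cube n) λ c → _) ≤⟨ *-mono-≤
        (≤-reflexive (cong₂ _*_ (length-tuples n d) (length-cube n)))
        (∑-mono (tuples n d) λ σ → ∑-mono (cube n) λ c → anchored-square σ c) ⟩
      total n d * ∑ (tuples n d) (λ σ → ∑ (cube n) λ c → ∑ (allFin n) (λ i → ∑ (allFin n) λ j → g⁺ (i ∷ j ∷ σ) c) + ∑ (allFin n) (λ i → anchored i σ c))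
        ≡⟨ cong (total n d *_) (trans (∑-cong (tuples n d) λ σ → ∑-+ (cube n) _ _) (∑-+ (tuples n d) _ _)) ⟩
      total n d * (∑ (tuples n d) (λ σ → ∑ (cube n) λ c → ∑ (allFin n) (λ i → ∑ (allFin n) λ j → g⁺ (i ∷ j ∷ σ) c)) + anchoredSum)
        ≡⟨ cong (λ z → total n d * (z + anchoredSum)) reorder ⟩
      total n d * (hom (merge? a Y?) S + anchoredSum) ∎
      where
      open ≤-Reasoning
      reorder : ∑ (tuples n d) (λ σ → ∑ (cube n) λ c → ∑ (allFin n) (λ i → ∑ (allFin n) λ j → g⁺ (i ∷ j ∷ σ) c)) ≡ hom (merge? a Y?) S
      reorder = begin-equality
        _ ≡⟨ ∑-cong (tuples n d) (λ σ → trans (∑-swap (cube n) (allFin n) _) (∑-cong (allFin n) λ i → ∑-swap (cube n) (allFin n) _)) ⟩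
        ∑ (tuples n d) (λ σ → ∑ (allFin n) λ i → ∑ (allFin n) λ j → ∑ (cube n) λ c → g⁺ (i ∷ j ∷ σ) c)
          ≡⟨ ∑-swap (tuples n d) (allFin n) _ ⟩
        ∑ (allFin n) (λ i → ∑ (tuples n d) λ σ → ∑ (allFin n) λ j → ∑ (cube n) λ c → g⁺ (i ∷ j ∷ σ) c)
          ≡⟨ ∑-cong (allFin n) (λ i → trans (∑-swap (tuples n d) (allFin n) _) (sym (∑-tuples n d _))) ⟩
        _ ≡⟨ ∑-tuples n (suc d) _ ⟨
        hom (merge? a Y?) S ∎

    anchoredSum≤ : anchoredSum ≤ total n (suc d)
    anchoredSum≤ = begin
      anchoredSum ≤⟨ ∑-mono (tuples n d) (λ σ → ∑-mono (cube n) λ c → ∑-mono (allFin n) λ i →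
                       *-mono-≤ (𝟙≤1 (lookup c i Bool.≟ a)) (𝟙≤1 (good? Y? S (i ∷ σ) c))) ⟩
      ∑ (tuples n d) (λ σ → ∑ (cube n) λ c → ∑ (allFin n) λ i → 1) ≡⟨ ∑-cong (tuples n d) (λ σ → ∑-cong (cube n) λ c → trans (∑-allFin-const n 1) (*-identityʳ n)) ⟩
      ∑ (tuples n d) (λ σ → ∑ (cube n) λ c → n) ≡⟨ ∑∑-const n d n ⟩
      total n d * n ≡⟨ trans (*-comm (total n d) n) (sym (*-assoc n (n ^ d) (2 ^ n))) ⟩
      total n (suc d) ∎
      where open ≤-Reasoning

  -- The old proportion is h = 2A/D and the new one H/(nD). From A² ≤ T(H + A), A ≤ D and D = nT
  -- follows h² ≤ 4H/(nD) + 4/n; this is inserted into the square of the old bound.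
  merge-arith : ∀ {n} L T A H C K R → .{{NonZero n}} → .{{NonZero T}} → let D = n * T in
    L * (n * D) ≤ (C * (n * (2 * A)) + K * D) * R → A * A ≤ T * (H + A) → A ≤ D →
    L * L * (n * (n * D)) ≤ (4 * (C * C) * (n * H) + (4 * (C * C) + 4 * (C * K) + K * K) * (n * D)) * (R * R)
  merge-arith {n} L T A H C K R ⦃ n≢0 ⦄ ⦃ T≢0 ⦄ bd cs A≤D = *-cancelʳ-≤ _ _ D ⦃ m*n≢0 n T ⦄ (begin
    L * L * (n * (n * D)) * D                          ≡⟨ a₁ L n D ⟩
    (L * (n * D)) * (L * (n * D))                      ≤⟨ *-mono-≤ bd bd ⟩
    ((C * (n * (2 * A)) + K * D) * R) * ((C * (n * (2 * A)) + K * D) * R) ≡⟨ a₂ C n A K D R ⟩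
    -- The factor 1 in the last term is raised to `n` in the next step, so that K² meets the same
    -- power of n as the other errors.
    (4 * (C * C) * (n * n) * (A * A) + 4 * (C * K) * (n * (A * D)) + K * K * (1 * D * D)) * (R * R)
      ≤⟨ *-monoˡ-≤ (R * R) (+-mono-≤ (+-mono-≤ (*-monoʳ-≤ (4 * (C * C) * (n * n)) cs)
           (*-monoʳ-≤ (4 * (C * K)) (*-monoʳ-≤ n (*-monoˡ-≤ D A≤D)))) (*-monoʳ-≤ (K * K) (*-monoˡ-≤ D (*-monoˡ-≤ D (>-nonZero⁻¹ n))))) ⟩
    (4 * (C * C) * (n * n) * (T * (H + A)) + 4 * (C * K) * (n * (D * D)) + K * K * (n * D * D)) * (R * R)
      ≡⟨ a₃ C n T H A K R ⟩
    (4 * (C * C) * (n * D) * H + 4 * (C * C) * (n * D) * A + 4 * (C * K) * (n * (D * D)) + K * K * (n * D * D)) * (R * R)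
      ≤⟨ *-monoˡ-≤ (R * R) (+-monoˡ-≤ (K * K * (n * D * D)) (+-monoˡ-≤ (4 * (C * K) * (n * (D * D)))
           (+-monoʳ-≤ (4 * (C * C) * (n * D) * H) (*-monoʳ-≤ (4 * (C * C) * (n * D)) A≤D)))) ⟩
    (4 * (C * C) * (n * D) * H + 4 * (C * C) * (n * D) * D + 4 * (C * K) * (n * (D * D)) + K * K * (n * D * D)) * (R * R)
      ≡⟨ a₄ C n D H K R ⟩
    (4 * (C * C) * (n * H) + (4 * (C * C) + 4 * (C * K) + K * K) * (n * D)) * (R * R) * D ∎)
    where
    open ≤-Reasoning
    D = n * T
    a₁ : ∀ L n D → L * L * (n * (n * D)) * D ≡ (L * (n * D)) * (L * (n * D))
    a₁ = solve-∀
    a₂ : ∀ C n A K D R → ((C * (n * (2 * A)) + K * D) * R) * ((C * (n * (2 * A)) + K * D) * R) ≡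
      (4 * (C * C) * (n * n) * (A * A) + 4 * (C * K) * (n * (A * D)) + K * K * (1 * D * D)) * (R * R)
    a₂ = solve-∀
    a₃ : ∀ C n T H A K R →
      (4 * (C * C) * (n * n) * (T * (H + A)) + 4 * (C * K) * (n * ((n * T) * (n * T))) + K * K * (n * (n * T) * (n * T))) * (R * R) ≡
      (4 * (C * C) * (n * (n * T)) * H + 4 * (C * C) * (n * (n * T)) * A + 4 * (C * K) * (n * ((n * T) * (n * T))) + K * K * (n * (n * T) * (n * T))) * (R * R)
    a₃ = solve-∀
    a₄ : ∀ C n D H K R →
      (4 * (C * C) * (n * D) * H + 4 * (C * C) * (n * D) * D + 4 * (C * K) * (n * (D * D)) + K * K * (n * D * D)) * (R * R) ≡
      (4 * (C * C) * (n * H) + (4 * (C * C) + 4 * (C * K) + K * K) * (n * D)) * (R * R) * D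
    a₄ = solve-∀

  total-suc : ∀ n d → total n (suc d) ≡ n * total n d
  total-suc n d = *-assoc n (n ^ d) (2 ^ n)

  total≢0 : ∀ n d .{{_ : NonZero n}} → NonZero (total n d)
  total≢0 n d = m*n≢0 (n ^ d) (2 ^ n) ⦃ m^n≢0 n d ⦄ ⦃ m^n≢0 2 n ⦄

  bounded-merge : ∀ a {Y : Vec Bool (suc d) → Set} {Y? : Decidable Y} → Bounded Y? → Bounded (merge? a Y?)
  bounded-merge {d} a {Y? = Y?} (C , K , r , nz , bd) =
    4 * (C * C) , 4 * (C * C) + 4 * (C * K) + K * K , r + r , >-nonZero (≤-trans (>-nonZero⁻¹ r ⦃ nz ⦄) (m≤m+n r r)) , bd′
    where
    bd′ : ∀ n → NonZero n → (S : Vec Bool n → Bool) → card S ^ (r + r) * (n * total n (suc (suc d))) ≤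
      (4 * (C * C) * (n * hom (merge? a Y?) S) + (4 * (C * C) + 4 * (C * K) + K * K) * total n (suc (suc d))) * (2 ^ n) ^ (r + r)
    bd′ n n≢0 S rewrite ^-distribˡ-+-* (card S) r r | ^-distribˡ-+-* (2 ^ n) r r | total-suc n (suc d) | total-suc n d =
      merge-arith {n} (card S ^ r) (total n d) (anchoredSum a Y? S) (hom (merge? a Y?) S) C K ((2 ^ n) ^ r)
        ⦃ n≢0 ⦄ ⦃ total≢0 n d ⦃ n≢0 ⦄ ⦄
        (subst₂ (λ h D → card S ^ r * (n * D) ≤ (C * (n * h) + K * D) * (2 ^ n) ^ r)
          (hom-anchored a Y? S) (total-suc n d) (bd n n≢0 S))
        (hom-merge a Y? S)
        (subst (anchoredSum a Y? S ≤_) (total-suc n d) (anchoredSum≤ a Y? S))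

  -- The counting bounds put the new coordinate first. `extract g` carries the first coordinate to
  -- position `g`, and `insert g` below does the reverse.
  extract : Fin (suc d) → (Vec Bool (suc d) → Set) → Vec Bool (suc d) → Set
  extract g Y x = Y (lookup x g ∷ removeAt x g)

  extract? : ∀ g {Y : Vec Bool (suc d) → Set} → Decidable Y → Decidable (extract g Y)
  extract? g Y? x = Y? (lookup x g ∷ removeAt x g)

  bounded-extract : ∀ g {Y : Vec Bool (suc d) → Set} {Y? : Decidable Y} → Bounded Y? → Bounded (extract? g Y?)
  bounded-extract g {Y} {Y?} = bounded-hom {Y? = Y?} {Z? = extract? g Y?} λ n S → sym (hom-move Y? (extract? g Y?) g S
    (λ a x → subst Y (sym (eq a x))) (λ a x → subst Y (eq a x)))
    where
    eq : ∀ a x → lookup (insertAt x g a) g ∷ removeAt (insertAt x g a) g ≡ a ∷ x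
    eq a x = cong₂ _∷_ (insertAt-lookup x g a) (removeAt-insertAt x g a)

  insert : Fin (suc d) → (Vec Bool (suc d) → Set) → Vec Bool (suc d) → Set
  insert g Y (a ∷ x) = Y (insertAt x g a)

  insert? : ∀ g {Y : Vec Bool (suc d) → Set} → Decidable Y → Decidable (insert g Y)
  insert? g Y? (a ∷ x) = Y? (insertAt x g a)

  bounded-insert : ∀ g {Y : Vec Bool (suc d) → Set} {Y? : Decidable Y} → Bounded Y? → Bounded (insert? g Y?)
  bounded-insert g {Y} {Y?} = bounded-hom {Y? = Y?} {Z? = insert? g Y?} λ n S → hom-move (insert? g Y?) Y? g S (λ _ _ → id) (λ _ _ → id)

  ∑-card : ∀ {n} (S : Vec Bool n → Bool) → card S ≡ ∑ (cube n) (λ c → 𝟙 (S c Bool.≟ true))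
  ∑-card {n} S = go (cube n)
    where
    go : ∀ xs → length (List.filterᵇ S xs) ≡ ∑ xs (λ c → 𝟙 (S c Bool.≟ true))
    go [] = refl
    go (x ∷ xs) with S x
    ... | true = cong suc (go xs)
    ... | false = go xs

  -- `X` comes without a decision procedure, so the placements of a decidable superset `Y` are
  -- counted; each of them also places `X`. In dimension 0 a placement is a point of `S`, which
  -- gives the constants 1, 0, 1.
  reducible⇒bounded : ∀ {X : Vec Bool d → Set} → Reducible X →
    Σ (Vec Bool d → Set) λ Y → Σ (Decidable Y) λ Y? → (∀ x → X x → Y x) × Bounded Y?
  reducible⇒bounded base = Y , Y? , (λ _ _ → _) , 1 , 0 , 1 , _ , bd
    where
    Y : Vec Bool 0 → Set
    Y _ = ⊤
    Y? : Decidable Y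
    Y? _ = yes tt
    card≤hom : ∀ {n} (S : Vec Bool n → Bool) → card S ≤ hom Y? S
    card≤hom {n} S = begin
      card S                                       ≡⟨ ∑-card S ⟩
      ∑ (cube n) (λ c → 𝟙 (S c Bool.≟ true))       ≤⟨ ∑-mono (cube n) (λ c → 𝟙-mono (S c Bool.≟ true) (good? Y? S [] c) λ p → (λ ()) , λ { [] _ → p }) ⟩
      ∑ (cube n) (λ c → 𝟙 (good? Y? S [] c))       ≡⟨ +-identityʳ _ ⟨
      hom Y? S                                     ∎
      where open ≤-Reasoning
    bd : ∀ n → NonZero n → (S : Vec Bool n → Bool) →
      card S ^ 1 * (n * total n 0) ≤ (1 * (n * hom Y? S) + 0 * total n 0) * (2 ^ n) ^ 1
    bd n _ S = ≤-trans (*-monoˡ-≤ (n * total n 0) (≤-trans (≤-reflexive (*-identityʳ (card S))) (card≤hom S)))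
      (≤-reflexive (arith (hom Y? S) n (2 ^ n)))
      where
      arith : ∀ h n N → h * (n * (1 * N)) ≡ (1 * (n * h) + 0 * (1 * N)) * (N * 1)
      arith = solve-∀
  reducible⇒bounded (fix {X = X} g a h red) with reducible⇒bounded red
  ... | Y , Y? , X⊆Y , bd = extract g (Const a Y) , extract? g (const? a Y?) ,
      (λ x p → map₂ (X⊆Y _) (h _ _ (subst X (sym (insertAt-removeAt x g)) p))) ,
      bounded-extract g {Y? = const? a Y?} (bounded-const a {Y? = Y?} bd)
  reducible⇒bounded (merge {X = X} {X′} g f a h red) with reducible⇒bounded red
  ... | Y , Y? , X⊆Y , bd = Z , extract? g (extract? (suc f) M?) , X⊆Z ,
      bounded-extract g {Y? = extract? (suc f) M?} (bounded-extract (suc f) {Y? = M?} (bounded-merge a {Y? = insert? f Y?} (bounded-insert f {Y? = Y?} bd)))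
    where
    M = Merge a (insert f Y)
    M? = merge? a (insert? f Y?)
    Z = extract g (extract (suc f) M)
    core : ∀ p y → X (insertAt y g p) → extract (suc f) M (p ∷ y)
    core p y@(_ ∷ _) xz with h p (lookup y f) (removeAt y f) (subst (λ z → X (insertAt z g p)) (sym (insertAt-removeAt y f)) xz)
    -- `extract (suc f)` hands the pair to `M` in the order q, p, so the two alternatives trade
    -- places.
    ... | inj₁ (e , x′) = inj₂ (e , X⊆Y _ x′)
    ... | inj₂ (e , x′) = inj₁ (e , X⊆Y _ x′)
    X⊆Z : ∀ x → X x → Z x
    X⊆Z x xx = core (lookup x g) (removeAt x g) (subst X (sym (insertAt-removeAt x g)) xx)

  -- From placements to oriented embeddings

  ZeroOn : ∀ {n d} → Vec (Fin n) d → Vec Bool n → Set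
  ZeroOn σ c = ∀ j → lookup c (lookup σ j) ≡ false

  abstract
    zeroOn? : ∀ {n d} (σ : Vec (Fin n) d) → Decidable (ZeroOn σ)
    zeroOn? σ c = all? λ j → lookup c (lookup σ j) Bool.≟ false

  -- Demanding the value 0 costs a factor 2 per coordinate of the image. Injectivity keeps the
  -- restricted function independent of the coordinates still to come.
  ∑-zeroOn : ∀ {n d} (σ : Vec (Fin n) d) (f : Vec Bool n → ℕ) → Inj σ →
    (∀ c j b → f (c [ lookup σ j ]≔ b) ≡ f c) →
    ∑ (cube n) f ≤ 2 ^ d * ∑ (cube n) (λ c → 𝟙 (zeroOn? σ c) * f c)
  ∑-zeroOn {n} [] f inj inv = ≤-reflexive (sym (trans (*-identityˡ _)
    (∑-cong (cube n) λ c → trans (cong (ℕ._* f c) (𝟙-yes (zeroOn? [] c) λ ())) (*-identityˡ (f c)))))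
  ∑-zeroOn {n} {suc d} (i ∷ σ) f inj inv = begin
    ∑ (cube n) f                                                          ≡⟨ ∑-cube-half false i f (λ c → inv c zero) ⟩
    2 * ∑ (cube n) f′                                                   ≤⟨ *-monoʳ-≤ 2 (∑-zeroOn σ f′ inj′ inv′) ⟩
    2 * (2 ^ d * ∑ (cube n) (λ c → 𝟙 (zeroOn? σ c) * f′ c))          ≡⟨ *-assoc 2 (2 ^ d) _ ⟨
    2 ^ suc d * ∑ (cube n) (λ c → 𝟙 (zeroOn? σ c) * f′ c)              ≤⟨ *-monoʳ-≤ (2 ^ suc d) (∑-mono (cube n) combine) ⟩
    2 ^ suc d * ∑ (cube n) (λ c → 𝟙 (zeroOn? (i ∷ σ) c) * f c)         ∎
    where
    open ≤-Reasoning
    inj′ = proj₁ (inj-insertAt⁻ {σ = σ} zero {i} inj)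
    new = proj₂ (inj-insertAt⁻ {σ = σ} zero {i} inj)
    f′ : Vec Bool n → ℕ
    f′ c = 𝟙 (lookup c i Bool.≟ false) * f c
    inv′ : ∀ c j b → f′ (c [ lookup σ j ]≔ b) ≡ f′ c
    inv′ c j b = cong₂ ℕ._*_ (cong (λ x → 𝟙 (x Bool.≟ false)) (lookup∘update′ (≢-sym (new j)) c b)) (inv c (suc j) b)
    combine : ∀ c → 𝟙 (zeroOn? σ c) * f′ c ≤ 𝟙 (zeroOn? (i ∷ σ) c) * f c
    combine c with zeroOn? σ c | lookup c i Bool.≟ false
    ... | no _ | _ = z≤n
    ... | yes _ | no _ = z≤n
    ... | yes z | yes e = ≤-reflexive (trans (*-identityˡ _) (cong (ℕ._* f c)
            (sym (𝟙-yes (zeroOn? (i ∷ σ) c) λ { zero → e ; (suc j) → z j }))))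

  cube-unique : ∀ n → Unique (cube n)
  cube-unique zero = [] ∷ []
  cube-unique (suc n) = Unique.++⁺ (Unique.map⁺ (proj₂ ∘ ∷-injective) (cube-unique n))
    (Unique.map⁺ (proj₂ ∘ ∷-injective) (cube-unique n)) λ (p , q) → disjoint (∈-map⁻ _ p) (∈-map⁻ _ q)
    where
    disjoint : ∀ {x : Vec Bool (suc n)} {P Q : Vec Bool n → Set} →
      (∃ λ y → P y × x ≡ false ∷ y) → (∃ λ y → Q y × x ≡ true ∷ y) → ⊥
    disjoint (_ , _ , refl) (_ , _ , ())

  tuples-unique : ∀ n d → Unique (tuples n d)
  tuples-unique n zero = [] ∷ []
  tuples-unique n (suc d) = Unique.cartesianProductWith⁺ _∷_ ∷-injective (Unique.allFin⁺ n) (tuples-unique n d)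

  module _ {n d : ℕ} {Y : Vec Bool d → Set} (Y? : Decidable Y) (S : Vec Bool n → Bool) where

    private
      Emb : Vec (Fin n) d × Vec Bool n → Set
      Emb (σ , c) = Good Y S σ c × ZeroOn σ c
      emb? : Decidable Emb
      emb? (σ , c) = good? Y? S σ c ×-dec zeroOn? σ c

    embeddings : List (Vec (Fin n) d × Vec Bool n)
    embeddings = filter emb? (cartesianProduct (tuples n d) (cube n))

    embeddings-good : All Emb embeddings
    embeddings-good = all-filter emb? (cartesianProduct (tuples n d) (cube n))

    embeddings-unique : Unique embeddings
    embeddings-unique = Unique.filter⁺ emb? (Unique.cartesianProduct⁺ (tuples-unique n d) (cube-unique n))

    -- Good placements fall into classes of 2ᵈ that agree off the image of `σ`; `embeddings` keeps
    -- the member that vanishes on the image, as the encoding of oriented embeddings requires.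
    hom≤embeddings : hom Y? S ≤ 2 ^ d * length embeddings
    hom≤embeddings = begin
      hom Y? S ≤⟨ ∑-mono (tuples n d) row ⟩
      ∑ (tuples n d) (λ σ → 2 ^ d * ∑ (cube n) λ c → 𝟙 (emb? (σ , c))) ≡⟨ ∑-*ˡ (tuples n d) (2 ^ d) _ ⟩
      2 ^ d * ∑ (tuples n d) (λ σ → ∑ (cube n) λ c → 𝟙 (emb? (σ , c)))
        ≡⟨ cong (2 ^ d *_) (trans (length-filter-∑ emb? (cartesianProduct (tuples n d) (cube n))) (∑-product _,_ (tuples n d) (cube n) _)) ⟨
      2 ^ d * length embeddings ∎
      where
      open ≤-Reasoning
      indep : ∀ {σ} c j b → Good Y S σ (c [ lookup σ j ]≔ b) → Good Y S σ c
      indep {σ} c j b (inj , h) = inj , λ x y → subst (λ z → S z ≡ true) (emb-overwrite {σ = σ} c x j b inj) (h x y)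
      indep⁻ : ∀ {σ} c j b → Good Y S σ c → Good Y S σ (c [ lookup σ j ]≔ b)
      indep⁻ {σ} c j b (inj , h) = inj , λ x y → subst (λ z → S z ≡ true) (sym (emb-overwrite {σ = σ} c x j b inj)) (h x y)
      both : ∀ σ c → 𝟙 (zeroOn? σ c) * 𝟙 (good? Y? S σ c) ≤ 𝟙 (emb? (σ , c))
      both σ c with zeroOn? σ c | good? Y? S σ c
      ... | no _ | _ = z≤n
      ... | yes z | no _ = z≤n
      ... | yes z | yes g = ≤-refl
      row : ∀ σ → ∑ (cube n) (λ c → 𝟙 (good? Y? S σ c)) ≤ 2 ^ d * ∑ (cube n) λ c → 𝟙 (emb? (σ , c))
      row σ with inj? σ
      ... | no ¬inj = ≤-trans (≤-reflexive (trans (∑-cong (cube n) λ c → 𝟙-no (good? Y? S σ c) (¬inj ∘ proj₁))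
                        (trans (∑-const (cube n) 0) (*-zeroʳ (length (cube n)))))) z≤n
      ... | yes inj = ≤-trans
              (∑-zeroOn σ (λ c → 𝟙 (good? Y? S σ c)) inj λ c j b →
                𝟙-cong (good? Y? S σ (c [ lookup σ j ]≔ b)) (good? Y? S σ c) (indep {σ} c j b) (indep⁻ {σ} c j b))
              (*-monoʳ-≤ (2 ^ d) (∑-mono (cube n) (both σ)))

  -- The falling factorial is at most the power. This is the harmless direction, since a lower bound
  -- proved against the larger count also holds against the smaller.
  numOrientedEmb≤ : ∀ d n → d ≤ n → numOrientedEmb d n * 2 ^ d ≤ total n d
  numOrientedEmb≤ d n d≤n = begin
    (n P d) * 2 ^ (n ∸ d) * 2 ^ d   ≡⟨ *-assoc (n P d) _ _ ⟩
    (n P d) * (2 ^ (n ∸ d) * 2 ^ d) ≡⟨ cong ((n P d) *_) (trans (sym (^-distribˡ-+-* 2 (n ∸ d) d)) (cong (2 ^_) (m∸n+n≡m d≤n))) ⟩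
    (n P d) * 2 ^ n                   ≤⟨ *-monoˡ-≤ (2 ^ n) nPd≤n^d ⟩
    total n d                           ∎
    where
    open ≤-Reasoning
    nP′d≤n^d : ∀ d → n P′ d ≤ n ^ d
    nP′d≤n^d zero = ≤-refl
    nP′d≤n^d (suc d) = *-mono-≤ (m∸n≤m n d) (nP′d≤n^d d)
    nPd≤n^d : n P d ≤ n ^ d
    nPd≤n^d with d ℕ.≤ᵇ n
    ... | true = nP′d≤n^d d
    ... | false = z≤n

  -- By the last hypothesis the error is at most half of the left side, so after doubling it can be
  -- cancelled.
  absorb-error : ∀ {n d} s C K R H N ℓ .{{_ : NonZero n}} → N * 2 ^ d ≤ total n d → H ≤ 2 ^ d * ℓ →
    s * (n * total n d) ≤ (C * (n * H) + K * total n d) * R →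
    R * (2 * K) ≤ s * n → s * N ≤ suc (2 * C) * R * ℓ
  absorb-error {n} {d} s C K R H N ℓ N≤D H≤ bd large = ≤-trans
    (*-cancelʳ-≤ _ _ (2 ^ d) ⦃ m^n≢0 2 d ⦄ (begin
      s * N * 2 ^ d                  ≡⟨ *-assoc s N (2 ^ d) ⟩
      s * (N * 2 ^ d)                ≤⟨ *-monoʳ-≤ s N≤D ⟩
      s * D                            ≤⟨ *-cancelˡ-≤ n main ⟩
      2 * C * H * R                ≤⟨ *-monoˡ-≤ R (*-monoʳ-≤ (2 * C) H≤) ⟩
      2 * C * (2 ^ d * ℓ) * R    ≡⟨ arith₁ C (2 ^ d) ℓ R ⟩
      2 * C * R * ℓ * 2 ^ d      ∎))
    -- The step from 2C to 2C + 1 gives c₃ a nonzero denominator whatever C is.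
    (*-monoˡ-≤ ℓ (*-monoˡ-≤ R (n≤1+n (2 * C))))
    where
    open ≤-Reasoning
    D = total n d
    arith₁ : ∀ C p ℓ R → 2 * C * (p * ℓ) * R ≡ 2 * C * R * ℓ * p
    arith₁ = solve-∀
    double : ∀ n s D → n * (s * D) + s * n * D ≡ 2 * (s * (n * D))
    double = solve-∀
    expand : ∀ n C H K D R → 2 * ((C * (n * H) + K * D) * R) ≡ n * (2 * C * H * R) + R * (2 * K) * D
    expand = solve-∀
    main : n * (s * D) ≤ n * (2 * C * H * R)
    main = +-cancelʳ-≤ (s * n * D) _ _ (begin
      n * (s * D) + s * n * D                          ≡⟨ double n s D ⟩
      2 * (s * (n * D))                                    ≤⟨ *-monoʳ-≤ 2 bd ⟩
      2 * ((C * (n * H) + K * D) * R)                ≡⟨ expand n C H K D R ⟩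
      n * (2 * C * H * R) + R * (2 * K) * D      ≤⟨ +-monoʳ-≤ (n * (2 * C * H * R)) (*-monoˡ-≤ D large) ⟩
      n * (2 * C * H * R) + s * n * D              ∎)

open Counting
open import Data.Integer using (+_)
import Data.Integer as ℤ
import Data.Integer.Properties as ℤ
import Data.Rational.Properties as ℚ
import Data.Rational.Solver as ℚ-Solver
open import Data.Rational.Unnormalised as ℚᵘ using (mkℚᵘ; *≡*; *≤*)
import Data.Rational.Unnormalised.Properties as ℚᵘ
open import Data.Rational as ℚ using (ℚ; Positive; 1ℚ; _*_; _/_) renaming (_≤_ to _≤ᵠ_)

-- From ℕ to ℚ

toℚᵘ-/ : ∀ m q .{{_ : NonZero q}} → ℚ.toℚᵘ (+ m / q) ℚᵘ.≃ (+ m ℚᵘ./ q)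
toℚᵘ-/ m (suc q) = ℚ.toℚᵘ-fromℚᵘ (mkℚᵘ (+ m) q)

⟦⟧-* : ∀ m n → ⟦ m ℕ.* n ⟧ ≡ ⟦ m ⟧ * ⟦ n ⟧
⟦⟧-* m n = ℚ.toℚᵘ-injective (begin
  ℚ.toℚᵘ ⟦ m ℕ.* n ⟧                     ≈⟨ toℚᵘ-/ (m ℕ.* n) 1 ⟩
  mkℚᵘ (+ (m ℕ.* n)) 0                   ≈⟨ *≡* (cong (ℤ._* (+ 1)) (ℤ.pos-* m n)) ⟩
  mkℚᵘ (+ m) 0 ℚᵘ.* mkℚᵘ (+ n) 0         ≈⟨ ℚᵘ.*-cong (toℚᵘ-/ m 1) (toℚᵘ-/ n 1) ⟨
  ℚ.toℚᵘ ⟦ m ⟧ ℚᵘ.* ℚ.toℚᵘ ⟦ n ⟧         ≈⟨ ℚ.toℚᵘ-homo-* ⟦ m ⟧ ⟦ n ⟧ ⟨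
  ℚ.toℚᵘ (⟦ m ⟧ * ⟦ n ⟧)                 ∎)
  where open ℚᵘ.≃-Reasoning

⟦⟧-mono-≤ : ∀ {m n} → m ≤ n → ⟦ m ⟧ ≤ᵠ ⟦ n ⟧
⟦⟧-mono-≤ {m} {n} p = ℚ.toℚᵘ-cancel-≤ (ℚᵘ.≤-respˡ-≃ (ℚᵘ.≃-sym (toℚᵘ-/ m 1)) (ℚᵘ.≤-respʳ-≃ (ℚᵘ.≃-sym (toℚᵘ-/ n 1))
  (*≤* (ℤ.*-monoʳ-≤-nonNeg (+ 1) (ℤ.+≤+ p)))))

⟦⟧-cancel-≤ : ∀ {m n} → ⟦ m ⟧ ≤ᵠ ⟦ n ⟧ → m ≤ n
⟦⟧-cancel-≤ {m} {n} p with ℚᵘ.≤-respˡ-≃ (toℚᵘ-/ m 1) (ℚᵘ.≤-respʳ-≃ (toℚᵘ-/ n 1) (ℚ.toℚᵘ-mono-≤ p))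
... | *≤* q = ℤ.drop‿+≤+ (ℤ.*-cancelʳ-≤-pos (+ m) (+ n) (+ 1) q)

⟦⟧-*-/ : ∀ m q .{{_ : NonZero q}} → ⟦ q ⟧ * (+ m / q) ≡ ⟦ m ⟧
⟦⟧-*-/ m q@(suc q′) = ℚ.toℚᵘ-injective (begin
  ℚ.toℚᵘ (⟦ q ⟧ * (+ m / q))             ≈⟨ ℚ.toℚᵘ-homo-* ⟦ q ⟧ (+ m / q) ⟩
  ℚ.toℚᵘ ⟦ q ⟧ ℚᵘ.* ℚ.toℚᵘ (+ m / q)     ≈⟨ ℚᵘ.*-cong (toℚᵘ-/ q 1) (toℚᵘ-/ m q) ⟩
  mkℚᵘ (+ q) 0 ℚᵘ.* mkℚᵘ (+ m) q′        ≈⟨ *≡* (trans (ℤ.*-identityʳ _) (trans (ℤ.*-comm (+ q) (+ m)) (cong (λ z → + m ℤ.* + z) (sym (+-identityʳ q))))) ⟩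
  mkℚᵘ (+ m) 0                           ≈⟨ toℚᵘ-/ m 1 ⟨
  ℚ.toℚᵘ ⟦ m ⟧                           ∎)
  where open ℚᵘ.≃-Reasoning

^ᵠ-* : ∀ p q k → (p * q) ^ᵠ k ≡ (p ^ᵠ k) * (q ^ᵠ k)
^ᵠ-* p q zero = refl
^ᵠ-* p q (suc k) = trans (cong ((p * q) *_) (^ᵠ-* p q k)) (lemma p q (p ^ᵠ k) (q ^ᵠ k))
  where
  open ℚ-Solver.+-*-Solver using (solve; _:*_; _:=_; con)
  lemma : ∀ a b c d → (a * b) * (c * d) ≡ (a * c) * (b * d)
  lemma = solve 4 (λ a b c d → (a :* b) :* (c :* d) := (a :* c) :* (b :* d)) refl

⟦⟧-^ : ∀ m k → ⟦ m ^ k ⟧ ≡ ⟦ m ⟧ ^ᵠ k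
⟦⟧-^ m zero = refl
⟦⟧-^ m (suc k) = trans (⟦⟧-* m (m ^ k)) (cong (⟦ m ⟧ *_) (⟦⟧-^ m k))

density-^ : ∀ {n} (S : Vec Bool n → Bool) r → ⟦ (2 ^ n) ^ r ⟧ * (density S ^ᵠ r) ≡ ⟦ card S ^ r ⟧
density-^ {n} S r = begin
  ⟦ (2 ^ n) ^ r ⟧ * (density S ^ᵠ r)       ≡⟨ cong (_* (density S ^ᵠ r)) (⟦⟧-^ (2 ^ n) r) ⟩
  (⟦ 2 ^ n ⟧ ^ᵠ r) * (density S ^ᵠ r)      ≡⟨ ^ᵠ-* ⟦ 2 ^ n ⟧ (density S) r ⟨
  (⟦ 2 ^ n ⟧ * density S) ^ᵠ r             ≡⟨ cong (_^ᵠ r) (⟦⟧-*-/ (card S) (2 ^ n) ⦃ m^n≢0 2 n ⦄) ⟩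
  ⟦ card S ⟧ ^ᵠ r                          ≡⟨ ⟦⟧-^ (card S) r ⟨
  ⟦ card S ^ r ⟧                           ∎
  where open ≡-Reasoning

⟦⟧-nonNeg : ∀ m → ℚ.NonNegative ⟦ m ⟧
⟦⟧-nonNeg m = ℚ.normalize-nonNeg m 1

hypothesis-ℕ : ∀ {n} (S : Vec Bool n → Bool) B r → (⟦ B ⟧ ^ᵠ r) ≤ᵠ ((density S ^ᵠ r) * ⟦ n ^ 1 ⟧) →
  (2 ^ n) ^ r ℕ.* B ^ r ≤ card S ^ r ℕ.* n
hypothesis-ℕ {n} S B r p = ⟦⟧-cancel-≤ (begin
  ⟦ (2 ^ n) ^ r ℕ.* B ^ r ⟧                              ≡⟨ trans (⟦⟧-* ((2 ^ n) ^ r) (B ^ r)) (cong (⟦ (2 ^ n) ^ r ⟧ *_) (⟦⟧-^ B r)) ⟩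
  ⟦ (2 ^ n) ^ r ⟧ * (⟦ B ⟧ ^ᵠ r)                         ≤⟨ ℚ.*-monoˡ-≤-nonNeg ⟦ (2 ^ n) ^ r ⟧ ⦃ ⟦⟧-nonNeg ((2 ^ n) ^ r) ⦄ p ⟩
  ⟦ (2 ^ n) ^ r ⟧ * ((density S ^ᵠ r) * ⟦ n ^ 1 ⟧)       ≡⟨ ℚ.*-assoc ⟦ (2 ^ n) ^ r ⟧ _ _ ⟨
  ⟦ (2 ^ n) ^ r ⟧ * (density S ^ᵠ r) * ⟦ n ^ 1 ⟧         ≡⟨ cong₂ _*_ (density-^ S r) (cong ⟦_⟧ (*-identityʳ n)) ⟩
  ⟦ card S ^ r ⟧ * ⟦ n ⟧                                 ≡⟨ ⟦⟧-* (card S ^ r) n ⟨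
  ⟦ card S ^ r ℕ.* n ⟧                                   ∎)
  where open ℚ.≤-Reasoning

-- Multiplying by `M` and by the r-th power of 2ⁿ clears the denominators of c₃ and of the density.
conclusion-ℚ : ∀ {n} (S : Vec Bool n → Bool) M .{{_ : NonZero M}} r N ℓ →
  card S ^ r ℕ.* N ≤ M ℕ.* (2 ^ n) ^ r ℕ.* ℓ →
  ((((+ 1 / M) ^ᵠ 1) * (density S ^ᵠ r)) * (⟦ N ⟧ ^ᵠ 1)) ≤ᵠ (⟦ ℓ ⟧ ^ᵠ 1)
conclusion-ℚ {n} S M r N ℓ p = ℚ.*-cancelˡ-≤-pos ⟦ M ℕ.* R ⟧
  ⦃ ℚ.normalize-pos (M ℕ.* R) 1 ⦄ (begin
  ⟦ M ℕ.* R ⟧ * (((c * 1ℚ) * δ) * (⟦ N ⟧ * 1ℚ))   ≡⟨ cong (_* (((c * 1ℚ) * δ) * (⟦ N ⟧ * 1ℚ))) (⟦⟧-* M R) ⟩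
  (⟦ M ⟧ * ⟦ R ⟧) * (((c * 1ℚ) * δ) * (⟦ N ⟧ * 1ℚ)) ≡⟨ lemma ⟦ M ⟧ ⟦ R ⟧ c δ ⟦ N ⟧ ⟩
  (⟦ M ⟧ * c) * ((⟦ R ⟧ * δ) * ⟦ N ⟧)             ≡⟨ cong₂ (λ x y → x * (y * ⟦ N ⟧)) (⟦⟧-*-/ 1 M) (density-^ S r) ⟩
  1ℚ * (⟦ card S ^ r ⟧ * ⟦ N ⟧)                   ≡⟨ trans (ℚ.*-identityˡ _) (sym (⟦⟧-* (card S ^ r) N)) ⟩
  ⟦ card S ^ r ℕ.* N ⟧                            ≤⟨ ⟦⟧-mono-≤ p ⟩
  ⟦ M ℕ.* R ℕ.* ℓ ⟧                               ≡⟨ trans (⟦⟧-* (M ℕ.* R) ℓ) (cong (⟦ M ℕ.* R ⟧ *_) (sym (ℚ.*-identityʳ ⟦ ℓ ⟧))) ⟩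
  ⟦ M ℕ.* R ⟧ * (⟦ ℓ ⟧ * 1ℚ)                      ∎)
  where
  open ℚ.≤-Reasoning
  open ℚ-Solver.+-*-Solver using (solve; _:*_; _:=_; con)
  R = (2 ^ n) ^ r
  instance
    R≢0 : NonZero R
    R≢0 = m^n≢0 (2 ^ n) r ⦃ m^n≢0 2 n ⦄
    MR≢0 : NonZero (M ℕ.* R)
    MR≢0 = m*n≢0 M R
  c = + 1 / M
  δ = density S ^ᵠ r
  lemma : ∀ m r c d k → (m * r) * (((c * 1ℚ) * d) * (k * 1ℚ)) ≡ (m * c) * ((r * d) * k)
  lemma = solve 5 (λ m r c d k → (m :* r) :* (((c :* con 1ℚ) :* d) :* (k :* con 1ℚ)) := (m :* c) :* ((r :* d) :* k)) refl

m≤m^r : ∀ m r .{{_ : NonZero m}} .{{_ : NonZero r}} → m ≤ m ^ r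
m≤m^r m (suc r) = m≤m*n m (m ^ r) ⦃ m^n≢0 m r ⦄

theorem3p10 : (G : Multigraph) → Connected G → SeriesParallel G →
    Σ ℚ λ c₁ → Σ ℚ λ c₃ → Σ ℕ λ a → Σ ℕ λ b → Σ ℕ λ r → Σ ℕ λ s →
    Positive c₁ × Positive c₃ × NonZero a × NonZero b × NonZero r × NonZero s ×
    ((n : ℕ) → e G ≤ n → (S : Vec Bool n → Bool) →
    (c₁ ^ᵠ b) ≤ᵠ ((density S ^ᵠ b) * ⟦ n ^ a ⟧) →
    Σ (List (Vec (Fin n) (e G) × Vec Bool n)) λ L →
    Unique L ×
    All (IsOrientedEmb (e G) n) L ×
    All (λ ψ → (x : Vec Bool (e G)) → X G x → S (applyEmb ψ x) ≡ true) L ×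
    (((c₃ ^ᵠ s) * (density S ^ᵠ r)) * (⟦ numOrientedEmb (e G) n ⟧ ^ᵠ s)) ≤ᵠ (⟦ length L ⟧ ^ᵠ s))
theorem3p10 G conn sp with reducible⇒bounded (reducible (e G) (ends G) conn sp)
... | Y , Y? , X⊆Y , C , K , r , r≢0 , bd =
  -- The exponents are c₂ = 1/r and c₄ = r/1. Taking 2K + 1 instead of 2K makes c₁ positive even for
  -- K = 0.
  ⟦ suc (2 ℕ.* K) ⟧ , (+ 1 / suc (2 ℕ.* C)) , 1 , r , r , 1 ,
  ℚ.normalize-pos (suc (2 ℕ.* K)) 1 , ℚ.normalize-pos 1 (suc (2 ℕ.* C)) , _ , r≢0 , r≢0 , _ ,
  λ n d≤n S dense →
    let instance _ = r≢0
        large : (2 ^ n) ^ r ℕ.* suc (2 ℕ.* K) ^ r ≤ card S ^ r ℕ.* n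
        large = hypothesis-ℕ S (suc (2 ℕ.* K)) r dense
        instance n≢0 : NonZero n
                 n≢0 = nonZero n r (card S ^ r) K large
    in
    embeddings Y? S ,
    embeddings-unique Y? S ,
    All.map (λ ((inj , _) , z) → inj , z) (embeddings-good Y? S) ,
    All.map (λ ((_ , h) , _) x t → h x (X⊆Y x t)) (embeddings-good Y? S) ,
    conclusion-ℚ S (suc (2 ℕ.* C)) r (numOrientedEmb (e G) n) (length (embeddings Y? S))
      (absorb-error {n} {e G} (card S ^ r) C K ((2 ^ n) ^ r) (hom Y? S) _ _ (numOrientedEmb≤ (e G) n d≤n)
        (hom≤embeddings Y? S) (bd n n≢0 S)
        (≤-trans (*-monoʳ-≤ ((2 ^ n) ^ r) (≤-trans (n≤1+n (2 ℕ.* K)) (m≤m^r (suc (2 ℕ.* K)) r))) large))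
  where
  -- At n = 0 the right side vanishes and the left does not. For a graph without edges, `e G ≤ n`
  -- leaves this case open, and the density hypothesis excludes it.
  nonZero : ∀ n r s K → (2 ^ n) ^ r ℕ.* suc (2 ℕ.* K) ^ r ≤ s ℕ.* n → NonZero n
  nonZero (suc n) r s K p = _
  nonZero zero r s K p = contradiction
    (≤-trans (ℕ.>-nonZero⁻¹ _ ⦃ m*n≢0 ((2 ^ 0) ^ r) (suc (2 ℕ.* K) ^ r) ⦃ m^n≢0 1 r ⦄ ⦃ m^n≢0 (suc (2 ℕ.* K)) r ⦄ ⦄)
      (≤-trans p (≤-reflexive (*-zeroʳ s)))) λ ()
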